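{- Let $K$ be a field of characteristic $0$, let $k\ge2$, and let $f(z)=\sum_{n=0}^\infty a_nz^n\in K[[z]]$ be a $k$-Mahler power series. Then $(a_n)_{n\ge0}$ is $k$-automatic if and only if $\{a_n:n\ge0\}$ is finite.
   Context: $f\in K[[z]]$ is $k$-Mahler if there are $d\ge0$ and polynomials $p_0,\dots,p_d\in K[z]$, not all zero, with $\sum_{i=0}^dp_i(z)f(z^{k^i})=0$. A sequence is $k$-automatic if its $k$-kernel $\{(a_{k^en+r})_{n\ge0}: e\ge0, 0\le r<k^e\}$ is a finite set. -}

module Defs where

open import Level using (Level; _⊔_) renaming (suc to lsuc)
open import Algebra.Bundles using (CommutativeRing)
open import Data.Nat using (ℕ; zero; suc; _^_; _<_; _≤_)
open import Data.Nat.Divisibility using (_∣?_; divides)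
open import Data.List using (List; []; _∷_)
open import Data.List.Relation.Unary.Any using (Any)
open import Data.Product using (Σ; ∃; _×_; _,_)
open import Relation.Nullary using (¬_; yes; no)

record Field (c ℓ : Level) : Set (lsuc (c ⊔ ℓ)) where
  field
    commutativeRing : CommutativeRing c ℓ
  open CommutativeRing commutativeRing public
  field
    1≉0     : ¬ (1# ≈ 0#)
    inverse : ∀ x → ¬ (x ≈ 0#) → Σ Carrier (λ y → x * y ≈ 1#)

module _ {c ℓ : Level} (K : Field c ℓ) where
  open Field K using (Carrier; _≈_; _+_; _*_; 0#; 1#)

  natK : ℕ → Carrier
  natK zero    = 0#
  natK (suc n) = 1# + natK n

  CharZero : Set ℓ
  CharZero = ∀ n → ¬ (natK (suc n) ≈ 0#)

  Series : Set c
  Series = ℕ → Carrier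

  -- polynomials over K: coefficient lists [c₀, c₁, …]
  Poly : Set c
  Poly = List Carrier

  substPow : ℕ → Series → Series
  substPow q a n with q ∣? n
  ... | yes (divides m _) = a m
  ... | no _              = 0#

  -- coefficients of p(z) · g(z)  (p = c₀ + z·p')
  polyMul : Poly → Series → Series
  polyMul []       g n       = 0#
  polyMul (c ∷ cs) g zero    = c * g zero
  polyMul (c ∷ cs) g (suc n) = c * g (suc n) + polyMul cs g n

  -- coefficients of Σ_{i} p_{i₀+i}(z) f(z^{k^{i₀+i}}) for ps = [p_{i₀}, p_{i₀+1}, …]
  mahlerSumFrom : ℕ → ℕ → List Poly → Series → Series
  mahlerSumFrom k i []       a n = 0#
  mahlerSumFrom k i (p ∷ ps) a n =
    polyMul p (substPow (k ^ i) a) n + mahlerSumFrom k (suc i) ps a n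

  NonZeroPoly : Poly → Set (c ⊔ ℓ)
  NonZeroPoly p = Any (λ x → ¬ (x ≈ 0#)) p

  IsMahler : ℕ → Series → Set (c ⊔ ℓ)
  IsMahler k a = Σ (List Poly) λ ps →
    Any NonZeroPoly ps × (∀ n → mahlerSumFrom k 0 ps a n ≈ 0#)

  _≋_ : Series → Series → Set ℓ
  s ≋ t = ∀ n → s n ≈ t n

  -- a is k-automatic: the k-kernel {(a_{k^e n + r})_n : e ≥ 0, 0 ≤ r < k^e}
  -- is finite, i.e. contained (up to equality of sequences) in a finite list
  IsAutomatic : ℕ → Series → Set (c ⊔ ℓ)
  IsAutomatic k a = Σ (List Series) λ L →
    ∀ e r → r < k ^ e → Any (λ s → (λ n → a (k ^ e *ℕ n +ℕ r)) ≋ s) L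
    where open import Data.Nat using () renaming (_*_ to _*ℕ_; _+_ to _+ℕ_)

  FiniteRange : Series → Set (c ⊔ ℓ)
  FiniteRange a = Σ (List Carrier) λ L → ∀ n → Any (λ x → a n ≈ x) L

{-# OPTIONS --safe #-}
module Submission where

open import Defs
open import Algebra.Bundles using (CommutativeRing)
open import Data.Empty using (⊥-elim)
open import Data.Fin as Fin using (Fin; toℕ; fromℕ<; punchIn; combine; remQuot; funToFin; finToFun)
import Data.Fin.Properties as Finₚ
open import Data.List using (List; []; _∷_; _++_; length; lookup; map; tabulate)
open import Data.List.Membership.Propositional.Properties using (∈-lookup)
open import Data.List.Relation.Unary.All as All using (All; []; _∷_)
import Data.List.Relation.Unary.All.Properties as Allₚ
open import Data.List.Relation.Unary.AllPairs using (AllPairs; []; _∷_)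
import Data.List.Relation.Unary.AllPairs.Properties as AllPairsₚ
open import Data.List.Relation.Unary.Any as Any using (Any; here; there)
import Data.List.Relation.Unary.Any.Properties as Anyₚ
open import Data.Nat as ℕ using (ℕ; zero; suc; _≤_; _<_; z≤n; s≤s; _^_; _∸_; NonZero; _!)
open import Data.Nat.DivMod using (_/_; _%_; m≡m%n+[m/n]*n; m%n<n; m/n<m; m/n≤m; m<n*o⇒m/o<n; [m+kn]%n≡m%n; m<n⇒m%n≡m)
open import Data.Nat.Divisibility using (_∣_; _∣?_; divides; ∣-trans; m≤n⇒m!∣n!; m∣m*n)
open import Data.Nat.GeneralisedArithmetic using (fold)
open import Data.Nat.Induction using (<-rec)
import Data.Nat.Properties as ℕₚ
open import Data.Nat.Tactic.RingSolver using (solve-∀)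
open import Data.Product using (Σ; ∃; _×_; _,_; proj₁; proj₂)
open import Data.Sum using (_⊎_; inj₁; inj₂)
open import Data.Unit using (⊤; tt)
open import Function using (_∘_)
open import Function.Bundles using (_⇔_; mk⇔)
open import Level using (_⊔_; Lift; lift; lower) renaming (suc to lsuc)
open import Relation.Binary.Definitions using (tri<; tri≈; tri>)
open import Relation.Binary.PropositionalEquality as ≡ using (_≡_; _≢_)
open import Relation.Nullary using (¬_; Dec; yes; no)

-- Let a be a Mahler sequence with finitely many values. Call the values of a near n, k n, …, k^(d-1) n
-- the context of n. If n and n′ have the same context, put h_e(x) = a(k^e n + x) - a(k^e n′ + x) and
-- v_e(x) = h_e(x + k^e M) - h_e(x). The Mahler equation relates the v_e for different e, and v_e = 0 for
-- e < d. If the coefficients preceding a regular one vanish, then, by induction on e, v_e satisfies a linear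
-- recurrence of bounded order; having finitely many values it is periodic with a period dividing k^e M,
-- so h_e(x + t k^e M) is an arithmetic progression in t. It has finitely many values, so in characteristic 0
-- it is constant and v_e = 0. Hence g(n + M) - g(n) depends only on the context of n, for every
-- kernel sequence g, and the kernel sequences restricted to [0, Y] fall into a number of classes which
-- does not depend on Y.
--
-- Which contexts occur is undecidable, so one only identifies kernel sequences that agree on [0, Y]. The
-- resulting automaton produces a sequence which agrees with a on [0, Y]; for large Y it reaches all its
-- configurations there, so its output satisfies the Mahler equation and equals a, since solutions are
-- determined by finitely many coefficients.
--
-- Equality in K is undecidable as well, so the first nonzero coefficient of the equation cannot be found.
-- Instead one works modulo ideals: a coefficient x is regular modulo the x-saturation of an ideal Z and
-- vanishes on the relevant values modulo Z + x·span(values); as there are finitely many values, vanishing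
-- in both cases implies vanishing modulo Z.

-- depth b g bounds the number of region shrinkings used by Vanishing when g coefficients precede the
-- unit one; each elimination of one of the b labels doubles it.
double : ℕ → ℕ → ℕ
double f zero    = f
double f (suc t) = double f t ℕ.+ double f t

depth : ℕ → ℕ → ℕ
depth b zero    = 1
depth b (suc g) = double (depth b g) b ℕ.+ 1

-- Ideals and quotient rings

module Ideals {c ℓ} (R : CommutativeRing c ℓ) where
  open CommutativeRing R
  open import Algebra.Properties.Ring ring using (-1*x≈-x; x[y-z]≈xy-xz; [y-z]x≈yx-zx)
  open import Algebra.Properties.AbelianGroup +-abelianGroup
    using (⁻¹-anti-homo‿-; ⁻¹-∙-comm)
  open import Relation.Binary.Reasoning.Setoid setoid
  open import Algebra.Properties.CommutativeSemigroup +-commutativeSemigroup using (interchange)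

  record Ideal : Set (lsuc (c ⊔ ℓ)) where
    field
      _∈Z     : Carrier → Set (c ⊔ ℓ)
      ∈-resp  : ∀ {x y} → x ≈ y → x ∈Z → y ∈Z
      0∈      : 0# ∈Z
      +-∈     : ∀ {x y} → x ∈Z → y ∈Z → (x + y) ∈Z
      *-∈     : ∀ r {x} → x ∈Z → (r * x) ∈Z

    neg-∈ : ∀ {x} → x ∈Z → (- x) ∈Z
    neg-∈ {x} p = ∈-resp (-1*x≈-x x) (*-∈ (- 1#) p)

  _∈ᴵ_ : Carrier → Ideal → Set (c ⊔ ℓ)
  x ∈ᴵ Z = Ideal._∈Z Z x

  zeroIdeal : Ideal
  zeroIdeal = record
    { _∈Z    = λ x → Lift c (x ≈ 0#)
    ; ∈-resp = λ e p → lift (trans (sym e) (lower p))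
    ; 0∈     = lift refl
    ; +-∈    = λ p q → lift (trans (+-cong (lower p) (lower q)) (+-identityˡ 0#))
    ; *-∈    = λ r p → lift (trans (*-congˡ (lower p)) (zeroʳ r))
    }

  -- A unit is regular modulo every ideal, so the recursion over the coefficients can stop at it
  -- whatever ideal has been reached.
  unit-cancel : ∀ {x u} → x * u ≈ 1# → ∀ Z y → (x * y) ∈ᴵ Z → y ∈ᴵ Z
  unit-cancel {x} {u} xu≈1 Z y p =
    ∈-resp (trans (sym (*-assoc u x y)) (trans (*-congʳ (trans (*-comm u x) xu≈1)) (*-identityˡ y))) (*-∈ u p)
    where open Ideal Z

  telescope : ∀ x y z → (x - y) + (y - z) ≈ x - z
  telescope x y z = begin
    (x - y) + (y - z)      ≈⟨ +-assoc x (- y) (y - z) ⟩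
    x + (- y + (y - z))    ≈⟨ +-congˡ (sym (+-assoc (- y) y (- z))) ⟩
    x + ((- y + y) + - z)  ≈⟨ +-congˡ (+-congʳ (-‿inverseˡ y)) ⟩
    x + (0# + - z)         ≈⟨ +-congˡ (+-identityˡ (- z)) ⟩
    x - z                  ∎

  sub-+ : ∀ x y u v → (x + y) - (u + v) ≈ (x - u) + (y - v)
  sub-+ x y u v = trans (+-congˡ (sym (⁻¹-∙-comm u v))) (interchange x y (- u) (- v))

  module Quotient (Z : Ideal) where
    open Ideal Z

    infix 4 _≈ᶻ_
    _≈ᶻ_ : Carrier → Carrier → Set (c ⊔ ℓ)
    x ≈ᶻ y = (x - y) ∈Z

    ≈⇒≈ᶻ : ∀ {x y} → x ≈ y → x ≈ᶻ y
    ≈⇒≈ᶻ {x} {y} e = ∈-resp (sym (trans (+-congʳ e) (-‿inverseʳ y))) 0∈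

    symᶻ : ∀ {x y} → x ≈ᶻ y → y ≈ᶻ x
    symᶻ {x} {y} p = ∈-resp (⁻¹-anti-homo‿- x y) (neg-∈ p)

    transᶻ : ∀ {x y z} → x ≈ᶻ y → y ≈ᶻ z → x ≈ᶻ z
    transᶻ {x} {y} {z} p q = ∈-resp (telescope x y z) (+-∈ p q)

    +-congᶻ : ∀ {x y u v} → x ≈ᶻ y → u ≈ᶻ v → (x + u) ≈ᶻ (y + v)
    +-congᶻ {x} {y} {u} {v} p q = ∈-resp (sym (sub-+ x u y v)) (+-∈ p q)

    *-congᶻ : ∀ {x y u v} → x ≈ᶻ y → u ≈ᶻ v → (x * u) ≈ᶻ (y * v)
    *-congᶻ {x} {y} {u} {v} p q = transᶻ
      (∈-resp (trans (*-comm u (x - y)) ([y-z]x≈yx-zx u x y)) (*-∈ u p))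
      (∈-resp (x[y-z]≈xy-xz y u v) (*-∈ y q))

    -‿congᶻ : ∀ {x y} → x ≈ᶻ y → (- x) ≈ᶻ (- y)
    -‿congᶻ {x} {y} p = ∈-resp (sym (⁻¹-∙-comm x (- y))) (neg-∈ p)

    quotientRing : CommutativeRing c (c ⊔ ℓ)
    quotientRing = record
      { Carrier = Carrier ; _≈_ = _≈ᶻ_ ; _+_ = _+_ ; _*_ = _*_ ; -_ = -_ ; 0# = 0# ; 1# = 1#
      ; isCommutativeRing = record
        { isRing = record
          { +-isAbelianGroup = record
            { isGroup = record
              { isMonoid = record
                { isSemigroup = record
                  { isMagma = record
                    { isEquivalence = record
                      { refl = ≈⇒≈ᶻ refl ; sym = symᶻ ; trans = transᶻ }
                    ; ∙-cong = +-congᶻ }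
                  ; assoc = λ x y z → ≈⇒≈ᶻ (+-assoc x y z) }
                ; identity = (λ x → ≈⇒≈ᶻ (+-identityˡ x)) , (λ x → ≈⇒≈ᶻ (+-identityʳ x)) }
              ; inverse = (λ x → ≈⇒≈ᶻ (-‿inverseˡ x)) , (λ x → ≈⇒≈ᶻ (-‿inverseʳ x))
              ; ⁻¹-cong = -‿congᶻ }
            ; comm = λ x y → ≈⇒≈ᶻ (+-comm x y) }
          ; *-cong = *-congᶻ
          ; *-assoc = λ x y z → ≈⇒≈ᶻ (*-assoc x y z)
          ; *-identity = (λ x → ≈⇒≈ᶻ (*-identityˡ x)) , (λ x → ≈⇒≈ᶻ (*-identityʳ x))
          ; distrib = (λ x y z → ≈⇒≈ᶻ (distribˡ x y z)) , (λ x y z → ≈⇒≈ᶻ (distribʳ x y z)) }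
        ; *-comm = λ x y → ≈⇒≈ᶻ (*-comm x y) }
      }

    x-0≈x : ∀ x → x - 0# ≈ x
    x-0≈x x = trans (+-congˡ -0≈0) (+-identityʳ x)
      where
      -0≈0 : - 0# ≈ 0#
      -0≈0 = trans (sym (+-identityˡ (- 0#))) (-‿inverseʳ 0#)

    ∈⇒≈ᶻ0 : ∀ {x} → x ∈Z → x ≈ᶻ 0#
    ∈⇒≈ᶻ0 {x} = ∈-resp (sym (x-0≈x x))

    ≈ᶻ0⇒∈ : ∀ {x} → x ≈ᶻ 0# → x ∈Z
    ≈ᶻ0⇒∈ {x} = ∈-resp (x-0≈x x)

  module Saturation (Z : Ideal) (x : Carrier) where
    open Ideal Z

    pow : ℕ → Carrier → Carrier
    pow zero    y = y
    pow (suc l) y = x * pow l y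

    pow-cong : ∀ l {y z} → y ≈ z → pow l y ≈ pow l z
    pow-cong zero    e = e
    pow-cong (suc l) e = *-congˡ (pow-cong l e)

    pow-+ : ∀ l y z → pow l (y + z) ≈ pow l y + pow l z
    pow-+ zero    y z = refl
    pow-+ (suc l) y z = trans (*-congˡ (pow-+ l y z)) (distribˡ x _ _)

    swap-* : ∀ r y z → r * (y * z) ≈ y * (r * z)
    swap-* r y z = trans (sym (*-assoc r y z)) (trans (*-congʳ (*-comm r y)) (*-assoc y r z))

    pow-* : ∀ l r y → pow l (r * y) ≈ r * pow l y
    pow-* zero    r y = refl
    pow-* (suc l) r y = trans (*-congˡ (pow-* l r y)) (swap-* x r _)

    pow-∈ : ∀ l {y} → y ∈Z → pow l y ∈Z
    pow-∈ zero    p = p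
    pow-∈ (suc l) p = *-∈ x (pow-∈ l p)

    pow-comp : ∀ l l′ y → pow l (pow l′ y) ≈ pow l′ (pow l y)
    pow-comp zero    l′ y = refl
    pow-comp (suc l) l′ y = trans (*-congˡ (pow-comp l l′ y)) (sym (pow-* l′ x (pow l y)))

    -- The elements that some power of `x` sends into `Z`. Multiplication by `x` is injective modulo
    -- this ideal.
    saturation : Ideal
    saturation = record
      { _∈Z    = λ y → ∃ λ l → pow l y ∈Z
      ; ∈-resp = λ { e (l , p) → l , ∈-resp (pow-cong l e) p }
      ; 0∈     = 0 , 0∈
      ; +-∈    = λ { (l , p) (l′ , p′) → l ℕ.+ l′ , plus l l′ p p′ }
      ; *-∈    = λ { r (l , p) → l , ∈-resp (sym (pow-* l r _)) (*-∈ r p) }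
      }
      where
      pow-add : ∀ l l′ y → pow (l ℕ.+ l′) y ≈ pow l (pow l′ y)
      pow-add zero    l′ y = refl
      pow-add (suc l) l′ y = *-congˡ (pow-add l l′ y)
      plus : ∀ l l′ {y z} → pow l y ∈Z → pow l′ z ∈Z → pow (l ℕ.+ l′) (y + z) ∈Z
      plus l l′ {y} {z} p q = ∈-resp (sym (pow-+ (l ℕ.+ l′) y z)) (+-∈
        (∈-resp (trans (pow-comp l′ l y) (sym (pow-add l l′ y))) (pow-∈ l′ p))
        (∈-resp (sym (pow-add l l′ z)) (pow-∈ l q)))

  -- A finitely labelled family w, an ideal Z and a ring element x: if w vanishes both modulo the
  -- x-saturation of Z and modulo Z + x·span(w), then it vanishes modulo Z. This replaces the case
  -- distinction "x = 0 or x is regular", which is not available constructively.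
  module Fitting
    {Idx : Set} (w : Idx → Carrier)
    (Reg : ℕ → Idx → Set) (Reg-suc : ∀ {s i} → Reg (suc s) i → Reg s i)
    (b : ℕ) (label : Idx → ℕ) (label< : ∀ i → label i < b)
    (label-≈ : ∀ i j → label i ≡ label j → w i ≈ w j)
    where

    Reg-anti : ∀ t {s i} → Reg (t ℕ.+ s) i → Reg s i
    Reg-anti zero    p = p
    Reg-anti (suc t) p = Reg-anti t (Reg-suc p)

    module _ (Z : Ideal) (x : Carrier) where
      open Ideal Z

      -- The ideal `Z` + `x`·span(`w i` : `B i`), generated inductively so that proofs can rewrite
      -- its generators one by one.
      data Span (B : Idx → Set) : Carrier → Set (c ⊔ ℓ) where
        base : ∀ {y} → y ∈Z → Span B y
        gen  : ∀ r {i} → B i → Span B (r * (x * w i))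
        plus : ∀ {y z} → Span B y → Span B z → Span B (y + z)
        resp : ∀ {y z} → y ≈ z → Span B y → Span B z

      Span-* : ∀ {B} r {y} → Span B y → Span B (r * y)
      Span-* r (base p)   = base (*-∈ r p)
      Span-* r (gen q p)  = resp (*-assoc r q _) (gen (r * q) p)
      Span-* r (plus p q) = resp (sym (distribˡ r _ _)) (plus (Span-* r p) (Span-* r q))
      Span-* r (resp e p) = resp (*-congˡ e) (Span-* r p)

      spanIdeal : (Idx → Set) → Ideal
      spanIdeal B = record
        { _∈Z = Span B ; ∈-resp = resp ; 0∈ = base 0∈ ; +-∈ = plus ; *-∈ = Span-* }

      Span-bind : ∀ {B C} → (∀ {i} → B i → Span C (x * w i)) → ∀ {y} → Span B y → Span C y
      Span-bind f (base p)   = base p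
      Span-bind f (gen r p)  = Span-* r (f p)
      Span-bind f (plus p q) = plus (Span-bind f p) (Span-bind f q)
      Span-bind f (resp e p) = resp e (Span-bind f p)

      open Saturation Z x using (pow; pow-*; pow-cong; pow-+)

      Above : ℕ → ℕ → Idx → Set
      Above s t i = Reg s i × t ≤ label i

      -- Generators with the same label have the same value, so those labelled `t` add up to a
      -- single multiple of `x * w i`.
      separate : ∀ s t {i} → label i ≡ t → ∀ {y} → Span (Above s t) y →
                 Σ Carrier λ r → Σ Carrier λ z → Span (Above s (suc t)) z × y ≈ z + r * (x * w i)
      separate s t {i} li (base {y} p) = 0# , y , base p ,
        sym (trans (+-congˡ (zeroˡ _)) (+-identityʳ y))
      separate s t {i} li (gen r {j} (p , q)) with label j ℕ.≟ t
      ... | yes e = r , 0# , base 0∈ ,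
        trans (*-congˡ (*-congˡ (label-≈ j i (≡.trans e (≡.sym li))))) (sym (+-identityˡ _))
      ... | no ne = 0# , _ , gen r (p , ℕₚ.≤∧≢⇒< q (λ e → ne (≡.sym e))) ,
        sym (trans (+-congˡ (zeroˡ _)) (+-identityʳ _))
      separate s t li (plus p q) with separate s t li p | separate s t li q
      ... | r , z , a , e | r′ , z′ , a′ , e′ = r + r′ , z + z′ , plus a a′ ,
        trans (+-cong e e′) (trans (interchange z _ z′ _) (+-congˡ (sym (distribʳ _ r r′))))
      separate s t li (resp e p) with separate s t li p
      ... | r , z , a , e′ = r , z , a , trans (sym e) e′

      Span-pow : ∀ {B} l {y} → Span B y → Span B (pow l y)
      Span-pow zero    p = p
      Span-pow (suc l) p = Span-* x (Span-pow l p)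

      -- y = z + r x y gives x^l y ≡ r x^(l+1) y modulo the span
      descend : ∀ {B} {r y z} → y ≈ z + r * (x * y) → Span B z → ∀ l → Span B (pow l y) → Span B y
      descend e p zero    q = q
      descend {B} {r} {y} {z} e p (suc l) q = descend e p l
        (resp (sym (trans (pow-cong l e) (pow-+ l z _)))
          (plus (Span-pow l p)
                (resp (sym (trans (pow-* l r (x * y)) (*-congˡ (pow-* l x y)))) (Span-* r q))))

      -- Labels are eliminated one at a time. A generator `w j` of label `t` is itself expanded by
      -- the induction hypothesis, so `w j` = z + r x `w j` with z free of label `t`; as a power of
      -- `x` sends `w j` into `Z`, the last summand can be removed. The hypothesis serves once for
      -- `w i` and once for `w j`, hence the doubling.
      reduce : ∀ s₀ f →
        (∀ {i} → Reg s₀ i → ∃ λ l → pow l (w i) ∈Z) →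
        (∀ u {i} → Reg (f ℕ.+ (u ℕ.+ s₀)) i → Span (Reg (u ℕ.+ s₀)) (w i)) →
        ∀ t u {i} → Reg (double f t ℕ.+ (u ℕ.+ s₀)) i → Span (Above (u ℕ.+ s₀) t) (w i)
      reduce s₀ f nil h zero u p =
        Span-bind (λ q → resp (*-identityˡ _) (gen 1# (q , z≤n))) (h u p)
      reduce s₀ f nil h (suc t) u {i} p =
        Span-bind step (reduce s₀ f nil h t (F ℕ.+ u)
          (≡.subst (λ a → Reg a i) (≡.trans (ℕₚ.+-assoc F F (u ℕ.+ s₀)) (≡.cong (F ℕ.+_) (≡.sym (ℕₚ.+-assoc F u s₀)))) p))
        where
        F = double f t
        step : ∀ {j} → Above (F ℕ.+ u ℕ.+ s₀) t j → Span (Above (u ℕ.+ s₀) (suc t)) (x * w j)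
        step {j} (q , t≤) with label j ℕ.≟ t
        ... | no ne = resp (*-identityˡ _)
          (gen 1# (Reg-anti F (≡.subst (λ a → Reg a j) (ℕₚ.+-assoc F u s₀) q) , ℕₚ.≤∧≢⇒< t≤ (λ e → ne (≡.sym e))))
        ... | yes e = Span-* x (solve-label (≡.subst (λ a → Reg a j) (ℕₚ.+-assoc F u s₀) q))
          where
          solve-label : Reg (F ℕ.+ (u ℕ.+ s₀)) j → Span (Above (u ℕ.+ s₀) (suc t)) (w j)
          solve-label q′ with separate (u ℕ.+ s₀) t e (reduce s₀ f nil h t u q′)
                            | nil (Reg-anti u (Reg-anti F q′))
          ... | r , z , a , e′ | l , p′ = descend e′ a l (base p′)

      fitting : ∀ s₀ f →
        (∀ {i} → Reg s₀ i → ∃ λ l → pow l (w i) ∈Z) →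
        (∀ u {i} → Reg (f ℕ.+ (u ℕ.+ s₀)) i → Span (Reg (u ℕ.+ s₀)) (w i)) →
        ∀ {i} → Reg (double f b ℕ.+ s₀) i → w i ∈Z
      -- All labels are below `b`, so after `b` eliminations no generator is left.
      fitting s₀ f nil h p = collapse (reduce s₀ f nil h b 0 p)
        where
        collapse : ∀ {y} → Span (Above s₀ b) y → y ∈Z
        collapse (base q) = q
        collapse (gen r {j} (_ , q)) = ⊥-elim (ℕₚ.<⇒≱ (label< j) q)
        collapse (plus q q′) = +-∈ (collapse q) (collapse q′)
        collapse (resp e q) = ∈-resp e (collapse q)

    module Vanishing
      {Q : ℕ} (X : Fin Q → Carrier) (q₀ : Fin Q)
      (unit : ∀ Z y → (X q₀ * y) ∈ᴵ Z → y ∈ᴵ Z)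
      (leaf : ∀ Z s q →
        (∀ q′ → toℕ q′ < toℕ q → ∀ {i} → Reg s i → (X q′ * w i) ∈ᴵ Z) →
        (∀ y → (X q * y) ∈ᴵ Z → y ∈ᴵ Z) →
        ∀ {i} → Reg (suc s) i → w i ∈ᴵ Z)
      where

      -- Induction on the distance `g` to the unit coefficient. Let `x` be the coefficient at `n`.
      -- Modulo the saturation `x` is regular and `leaf` applies; modulo `Z` + `x`·span(`w`) it
      -- kills `w` like its predecessors and the induction hypothesis applies. The ideal changes at
      -- each step and is therefore arbitrary.
      claim : ∀ g n → n ℕ.+ g ≡ toℕ q₀ → ∀ Z s →
        (∀ q′ → toℕ q′ < n → ∀ {i} → Reg s i → (X q′ * w i) ∈ᴵ Z) →
        ∀ {i} → Reg (depth b g ℕ.+ s) i → w i ∈ᴵ Z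
      claim zero n eq Z s kill =
        leaf Z s q₀ (λ q′ lt → kill q′ (≡.subst (toℕ q′ <_) (≡.trans (≡.sym eq) (ℕₚ.+-identityʳ n)) lt)) (unit Z)
      claim (suc g) n eq Z s kill {i} p =
        fitting Z x (suc s) (depth b g)
          (λ r → leaf (saturation) s q
                   (λ q′ lt r′ → 0 , kill q′ (≡.subst (toℕ q′ <_) toℕq lt) r′)
                   (λ { y (l , m) → suc l , ∈-resp (pow-* l x y) m }) r)
          (λ u {j} r → claim g (suc n) (≡.trans (≡.sym (ℕₚ.+-suc n g)) eq)
                     (spanIdeal Z x (Reg (u ℕ.+ suc s))) (u ℕ.+ suc s) (kill′ u) r)
          (≡.subst (λ a → Reg a i) (ℕₚ.+-assoc (double (depth b g) b) 1 s) p)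
        where
        open Ideal Z
        n<Q : n < Q
        n<Q = ℕₚ.≤-<-trans (≡.subst (n ≤_) eq (ℕₚ.m≤m+n n (suc g))) (Finₚ.toℕ<n q₀)
        q : Fin Q
        q = fromℕ< n<Q
        toℕq : toℕ q ≡ n
        toℕq = Finₚ.toℕ-fromℕ< n<Q
        x : Carrier
        x = X q
        open Saturation Z x using (saturation; pow-*)
        kill′ : ∀ u q′ → toℕ q′ < suc n → ∀ {j} → Reg (u ℕ.+ suc s) j → Span Z x (Reg (u ℕ.+ suc s)) (X q′ * w j)
        kill′ u q′ lt {j} r with ℕₚ.m≤n⇒m<n∨m≡n (ℕₚ.≤-pred lt)
        ... | inj₁ lt′ = base (kill q′ lt′ (Reg-suc (Reg-anti u r)))
        ... | inj₂ e   = resp (trans (*-identityˡ _) (*-congʳ (reflexive (≡.cong X (≡.sym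
                           (Finₚ.toℕ-injective (≡.trans e (≡.sym toℕq)))))))) (gen 1# r)

      vanish : ∀ {i} → Reg (depth b (toℕ q₀)) i → w i ≈ 0#
      vanish {i} p = lower (claim (toℕ q₀) 0 ≡.refl zeroIdeal 0 (λ q′ ())
        (≡.subst (λ a → Reg a i) (≡.sym (ℕₚ.+-identityʳ _)) p))

-- Stated so that a linear inequality follows from its summed-up hypotheses a ≤ b by a semiring identity.
≤-linear : ∀ {a b} A B r → a ≤ b → A ℕ.+ b ℕ.+ r ≡ B ℕ.+ a → A ≤ B
≤-linear {a} {b} A B r a≤b eq = ℕₚ.+-cancelʳ-≤ b A B (begin
  A ℕ.+ b          ≤⟨ ℕₚ.m≤m+n (A ℕ.+ b) r ⟩
  A ℕ.+ b ℕ.+ r    ≡⟨ eq ⟩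
  B ℕ.+ a          ≤⟨ ℕₚ.+-monoʳ-≤ B a≤b ⟩
  B ℕ.+ b          ∎)
  where open ℕₚ.≤-Reasoning

-- Mahler equations

-- The exponent vectors (I q , J q) of the monomials z^j · f(z^(k^i)), in lexicographic order.
record Shape : Set where
  field
    Q d D : ℕ
    I J   : Fin Q → ℕ
    I<    : ∀ q → I q < d
    J≤    : ∀ q → J q ≤ D
    lex   : ∀ {q q′} → toℕ q < toℕ q′ → I q < I q′ ⊎ (I q ≡ I q′ × J q < J q′)

module Terms (k : ℕ) (2≤k : 2 ≤ k) where

  instance
    k≢0 : NonZero k
    k≢0 = ℕ.>-nonZero (ℕₚ.<-≤-trans (s≤s z≤n) 2≤k)

  k^≢0 : ∀ i → NonZero (k ^ i)
  k^≢0 i = ℕₚ.m^n≢0 k i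

  Hit : ℕ → ℕ → ℕ → Set
  Hit i n j = ∃ λ m → n ≡ k ^ i ℕ.* m ℕ.+ j

  hit? : ∀ i n j → Dec (Hit i n j)
  hit? i n j with j ℕ.≤? n
  ... | no j≰n = no λ { (m , e) → j≰n (≡.subst (j ≤_) (≡.sym e) (ℕₚ.m≤n+m j _)) }
  ... | yes j≤n with (k ^ i) ∣? (n ∸ j)
  ...   | yes (divides m e) = yes (m , ≡.trans (≡.sym (ℕₚ.m∸n+n≡m j≤n))
                                 (≡.cong (ℕ._+ j) (≡.trans e (ℕₚ.*-comm m (k ^ i)))))
  ...   | no ¬div = no λ { (m , e) → ¬div (divides m (≡.trans (≡.cong (_∸ j) e)
                        (≡.trans (ℕₚ.m+n∸n≡m _ j) (ℕₚ.*-comm (k ^ i) m)))) }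

  -- the coefficient of z^n in z^j · f(z^(k^i))
  term : ∀ {a} {A : Set a} → A → (ℕ → A) → ℕ → ℕ → ℕ → A
  term z f i n j with hit? i n j
  ... | yes (m , _) = f m
  ... | no _        = z

  hit-unique : ∀ i {n j m m′} → n ≡ k ^ i ℕ.* m ℕ.+ j → n ≡ k ^ i ℕ.* m′ ℕ.+ j → m ≡ m′
  hit-unique i {n} {j} {m} {m′} e e′ =
    ℕₚ.*-cancelˡ-≡ m m′ (k ^ i) {{k^≢0 i}} (ℕₚ.+-cancelʳ-≡ j _ _ (≡.trans (≡.sym e) e′))

  module _ {a} {A : Set a} {z : A} {f : ℕ → A} where

    term-hit : ∀ i {n} j {m} → n ≡ k ^ i ℕ.* m ℕ.+ j → term z f i n j ≡ f m
    term-hit i {n} j {m} e with hit? i n j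
    ... | yes (m′ , e′) = ≡.cong f (hit-unique i e′ e)
    ... | no ¬h         = ⊥-elim (¬h (m , e))

    term-elim : ∀ {p} (P : A → Set p) i n j →
      (∀ m → n ≡ k ^ i ℕ.* m ℕ.+ j → P (f m)) → P z → P (term z f i n j)
    term-elim P i n j h pz with hit? i n j
    ... | yes (m , e) = h m e
    ... | no _        = pz

    -- This turns the Mahler equation into relations between the blocks of `f` that start at
    -- `k ^ (E ∸ i) * n`, with `n` a mere parameter. The bound `j ≤ X` keeps the index read from
    -- dropping below the start of the block.
    term-shift : ∀ {E X} n i j → i ≤ E → j ≤ X →
      term z f i (k ^ E ℕ.* n ℕ.+ X) j ≡ term z (λ y → f (k ^ (E ∸ i) ℕ.* n ℕ.+ y)) i X j
    term-shift {E} {X} n i j i≤E j≤X with hit? i X j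
    ... | yes (y , e) = term-hit i j (begin
        k ^ E ℕ.* n ℕ.+ X                               ≡⟨ ≡.cong₂ (λ a b → a ℕ.* n ℕ.+ b) k^E e ⟩
        k ^ i ℕ.* F ℕ.* n ℕ.+ (k ^ i ℕ.* y ℕ.+ j)       ≡⟨ alg (k ^ i) F n y j ⟩
        k ^ i ℕ.* (F ℕ.* n ℕ.+ y) ℕ.+ j                 ∎)
      where
      open ≡.≡-Reasoning
      F = k ^ (E ∸ i)
      k^E : k ^ E ≡ k ^ i ℕ.* F
      k^E = ≡.trans (≡.cong (k ^_) (≡.sym (ℕₚ.m+[n∸m]≡n i≤E))) (ℕₚ.^-distribˡ-+-* k i (E ∸ i))
      alg : ∀ K F n y j → K ℕ.* F ℕ.* n ℕ.+ (K ℕ.* y ℕ.+ j) ≡ K ℕ.* (F ℕ.* n ℕ.+ y) ℕ.+ j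
      alg = solve-∀
    ... | no ¬h = term-elim (_≡ z) i _ j (λ m e → ⊥-elim (¬h (m ∸ F ℕ.* n , miss m e))) ≡.refl
      where
      F = k ^ (E ∸ i)
      k^E : k ^ E ≡ k ^ i ℕ.* F
      k^E = ≡.trans (≡.cong (k ^_) (≡.sym (ℕₚ.m+[n∸m]≡n i≤E))) (ℕₚ.^-distribˡ-+-* k i (E ∸ i))
      alg : ∀ K F n r → K ℕ.* F ℕ.* n ℕ.+ r ≡ K ℕ.* (F ℕ.* n) ℕ.+ r
      alg = solve-∀
      alg′ : ∀ K u v j → K ℕ.* (u ℕ.+ v) ℕ.+ j ≡ K ℕ.* u ℕ.+ (K ℕ.* v ℕ.+ j)
      alg′ = solve-∀
      miss : ∀ m → k ^ E ℕ.* n ℕ.+ X ≡ k ^ i ℕ.* m ℕ.+ j → X ≡ k ^ i ℕ.* (m ∸ F ℕ.* n) ℕ.+ j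
      miss m e = ℕₚ.+-cancelˡ-≡ (k ^ i ℕ.* (F ℕ.* n)) _ _ (begin
        k ^ i ℕ.* (F ℕ.* n) ℕ.+ X                             ≡⟨ alg (k ^ i) F n X ⟨
        k ^ i ℕ.* F ℕ.* n ℕ.+ X                               ≡⟨ ≡.cong (λ a → a ℕ.* n ℕ.+ X) k^E ⟨
        k ^ E ℕ.* n ℕ.+ X                                     ≡⟨ e ⟩
        k ^ i ℕ.* m ℕ.+ j                                     ≡⟨ ≡.cong (λ a → k ^ i ℕ.* a ℕ.+ j) (ℕₚ.m+[n∸m]≡n Fn≤m) ⟨
        k ^ i ℕ.* (F ℕ.* n ℕ.+ (m ∸ F ℕ.* n)) ℕ.+ j           ≡⟨ alg′ (k ^ i) (F ℕ.* n) _ j ⟩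
        k ^ i ℕ.* (F ℕ.* n) ℕ.+ (k ^ i ℕ.* (m ∸ F ℕ.* n) ℕ.+ j) ∎)
        where
        open ≡.≡-Reasoning
        Fn≤m : F ℕ.* n ≤ m
        Fn≤m = ℕₚ.*-cancelˡ-≤ (k ^ i) {{k^≢0 i}} (ℕₚ.+-cancelʳ-≤ j _ _
          (≡.subst (k ^ i ℕ.* (F ℕ.* n) ℕ.+ j ≤_)
             (≡.trans (≡.sym (alg (k ^ i) F n X)) (≡.trans (≡.cong (λ a → a ℕ.* n ℕ.+ X) (≡.sym k^E)) e))
             (ℕₚ.+-monoʳ-≤ _ j≤X)))

  term-rel : ∀ {a b r} {A : Set a} {B : Set b} {z : A} {f : ℕ → A} {z′ : B} {g : ℕ → B}
    (_~_ : A → B → Set r) i n j → (∀ m → n ≡ k ^ i ℕ.* m ℕ.+ j → f m ~ g m) → z ~ z′ →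
    term z f i n j ~ term z′ g i n j
  term-rel _~_ i n j h hz with hit? i n j
  ... | yes (m , e) = h m e
  ... | no _        = hz

-- Finite sums in a commutative ring

module Sums {c ℓ} (R : CommutativeRing c ℓ) where
  open CommutativeRing R
  open import Algebra.Properties.Ring ring using (x[y-z]≈xy-xz)
  open import Algebra.Properties.CommutativeMonoid.Sum +-commutativeMonoid public
    using (sum; sum-cong-≋; sum-remove; sum-replicate-zero)
  open Ideals R using (sub-+)

  sum-zero : ∀ {n} (t : Fin n → Carrier) → (∀ i → t i ≈ 0#) → sum t ≈ 0#
  sum-zero {n} t h = trans (sum-cong-≋ h) (sum-replicate-zero n)

  isolate : ∀ {n} (t : Fin n → Carrier) q → sum t ≈ 0# → (∀ q′ → q′ ≢ q → t q′ ≈ 0#) → t q ≈ 0#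
  isolate {suc n} t q s h = begin
    t q                            ≈⟨ +-identityʳ _ ⟨
    t q + 0#                       ≈⟨ +-congˡ (sum-zero _ (λ i → h (punchIn q i) (Finₚ.punchInᵢ≢i q i))) ⟨
    t q + sum (t ∘ punchIn q)      ≈⟨ sum-remove {i = q} t ⟨
    sum t                          ≈⟨ s ⟩
    0#                             ∎
    where open import Relation.Binary.Reasoning.Setoid setoid

  sum-sub : ∀ {n} (t u : Fin n → Carrier) → sum (λ i → t i - u i) ≈ sum t - sum u
  sum-sub {zero}  t u = sym (-‿inverseʳ 0#)
  sum-sub {suc n} t u = trans (+-congˡ (sum-sub (t ∘ Fin.suc) (u ∘ Fin.suc))) (sym (sub-+ _ _ _ _))

  weighted-sub : ∀ {n} (P t u v : Fin n → Carrier) → (∀ q → v q ≈ t q - u q) →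
    sum (λ q → P q * t q) ≈ 0# → sum (λ q → P q * u q) ≈ 0# → sum (λ q → P q * v q) ≈ 0#
  weighted-sub P t u v h s s′ = begin
    sum (λ q → P q * v q)                            ≈⟨ sum-cong-≋ (λ q → trans (*-congˡ (h q)) (x[y-z]≈xy-xz _ _ _)) ⟩
    sum (λ q → P q * t q - P q * u q)                ≈⟨ sum-sub (λ q → P q * t q) (λ q → P q * u q) ⟩
    sum (λ q → P q * t q) - sum (λ q → P q * u q)    ≈⟨ +-cong s (-‿cong s′) ⟩
    0# - 0#                                          ≈⟨ -‿inverseʳ 0# ⟩
    0#                                               ∎
    where open import Relation.Binary.Reasoning.Setoid setoid

-- Uniqueness of finitely valued solutions

module _ (k : ℕ) (2≤k : 2 ≤ k) (S : Shape) where
  open Terms k 2≤k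
  open Shape S

  module SolutionLeaf {c ℓ} (R : CommutativeRing c ℓ) where
    open CommutativeRing R
    open Sums R

    -- Strong induction on `n`: in the equation at `k ^ i * n + j` the terms before `q` are killed,
    -- and those after `q` in lexicographic order read `w` below `n`.
    leaf : (P : Fin Q → Carrier) (w : ℕ → Carrier) →
      (∀ N → sum (λ q → P q * term 0# w (I q) N (J q)) ≈ 0#) →
      (∀ n → n ≤ D → w n ≈ 0#) →
      ∀ q → (∀ q′ → toℕ q′ < toℕ q → ∀ n → P q′ * w n ≈ 0#) →
      (∀ y → P q * y ≈ 0# → y ≈ 0#) → ∀ n → w n ≈ 0#
    leaf P w eqn init q kill cancel = <-rec (λ n → w n ≈ 0#) step
      where
      i = I q
      j = J q
      step : ∀ n → (∀ {m} → m < n → w m ≈ 0#) → w n ≈ 0#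
      step n IH with n ℕ.≤? D
      ... | yes n≤D = init n n≤D
      ... | no n≰D = cancel (w n) (trans (*-congˡ (reflexive (≡.sym (term-hit i j ≡.refl))))
                       (isolate (λ q′ → P q′ * term 0# w (I q′) N (J q′)) q (eqn N) others))
        where
        N = k ^ i ℕ.* n ℕ.+ j
        D<n : D < n
        D<n = ℕₚ.≰⇒> n≰D
        below : ∀ q′ → toℕ q < toℕ q′ → ∀ m → N ≡ k ^ I q′ ℕ.* m ℕ.+ J q′ → m < n
        below q′ lt m e with lex lt
        ... | inj₂ (i≡ , j<) = ℕₚ.*-cancelˡ-< (k ^ i) m n (≤-linear _ _ 0 j<
                (≡.trans (alg (k ^ i ℕ.* m) (J q′)) (≡.trans (≡.cong suc (≡.trans (≡.cong (λ a → k ^ a ℕ.* m ℕ.+ J q′) i≡) (≡.sym e)))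
                  (≡.sym (ℕₚ.+-suc _ j)))))
          where
          alg : ∀ a b → suc a ℕ.+ b ℕ.+ 0 ≡ suc (a ℕ.+ b)
          alg = solve-∀
        -- Since `n` exceeds `D`, the position is below 2 `k ^ i` `n`, while `k ^ I q′` is at least
        -- 2 `k ^ i`.
        ... | inj₁ i< = ℕₚ.≰⇒> λ n≤m → ℕₚ.<-irrefl e (begin-strict
                k ^ i ℕ.* n ℕ.+ j                ≤⟨ ℕₚ.+-monoʳ-≤ _ (J≤ q) ⟩
                k ^ i ℕ.* n ℕ.+ D                <⟨ ℕₚ.+-monoʳ-< _ D<n ⟩
                k ^ i ℕ.* n ℕ.+ n                ≤⟨ ℕₚ.+-monoʳ-≤ _ (ℕₚ.m≤n*m n (k ^ i) {{k^≢0 i}}) ⟩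
                k ^ i ℕ.* n ℕ.+ k ^ i ℕ.* n      ≡⟨ alg (k ^ i) n ⟩
                2 ℕ.* k ^ i ℕ.* n                ≤⟨ ℕₚ.*-mono-≤ (ℕₚ.*-monoˡ-≤ (k ^ i) 2≤k) n≤m ⟩
                k ^ suc i ℕ.* m                  ≤⟨ ℕₚ.*-monoˡ-≤ m (ℕₚ.^-monoʳ-≤ k i<) ⟩
                k ^ I q′ ℕ.* m                   ≤⟨ ℕₚ.m≤m+n _ _ ⟩
                k ^ I q′ ℕ.* m ℕ.+ J q′          ∎)
          where
          open ℕₚ.≤-Reasoning
          alg : ∀ a n → a ℕ.* n ℕ.+ a ℕ.* n ≡ 2 ℕ.* a ℕ.* n
          alg = solve-∀
        others : ∀ q′ → q′ ≢ q → P q′ * term 0# w (I q′) N (J q′) ≈ 0#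
        others q′ ne with ℕₚ.<-cmp (toℕ q′) (toℕ q)
        ... | tri< lt _ _ = term-elim (λ y → P q′ * y ≈ 0#) (I q′) N (J q′) (λ m _ → kill q′ lt m) (zeroʳ _)
        ... | tri≈ _ e _ = ⊥-elim (ne (Finₚ.toℕ-injective e))
        ... | tri> _ _ gt = term-elim (λ y → P q′ * y ≈ 0#) (I q′) N (J q′)
                (λ m e → trans (*-congˡ (IH (below q′ gt m e))) (zeroʳ _)) (zeroʳ _)

  module Uniqueness {c ℓ} (R : CommutativeRing c ℓ) where
    open CommutativeRing R
    open Sums R
    open Ideals R

    -- `Vanishing` reduces this to a regular coefficient whose predecessors kill `w`. That case
    -- loses no positions, so every region is all of ℕ.
    uniqueness : (P : Fin Q → Carrier) (q₀ : Fin Q) (u : Carrier) → P q₀ * u ≈ 1# →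
      (w : ℕ → Carrier) (b : ℕ) (label : ℕ → ℕ) (label< : ∀ n → label n < b)
      (label-≈ : ∀ m n → label m ≡ label n → w m ≈ w n) →
      (∀ N → sum (λ q → P q * term 0# w (I q) N (J q)) ≈ 0#) →
      (∀ n → n ≤ D → w n ≈ 0#) → ∀ n → w n ≈ 0#
    uniqueness P q₀ u Pu≈1 w b label label< label-≈ eqn init n = vanish {n} tt
      where
      open Fitting w (λ _ _ → ⊤) (λ _ → tt) b label label< label-≈
      leaf′ : ∀ Z s q → (∀ q′ → toℕ q′ < toℕ q → ∀ {i} → ⊤ → (P q′ * w i) ∈ᴵ Z) →
        (∀ y → (P q * y) ∈ᴵ Z → y ∈ᴵ Z) → ∀ {i} → ⊤ → w i ∈ᴵ Z
      leaf′ Z s q kill cancel {m} _ = ≈ᶻ0⇒∈ (SolutionLeaf.leaf quotientRing P w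
        (λ N → ≈⇒≈ᶻ (eqn N)) (λ n p → ≈⇒≈ᶻ (init n p)) q
        (λ q′ lt n → ∈⇒≈ᶻ0 (kill q′ lt {n} tt)) (λ y p → ∈⇒≈ᶻ0 (cancel y (≈ᶻ0⇒∈ p))) m)
        where open Quotient Z
      open Vanishing P q₀ (unit-cancel Pu≈1) leaf′

funToFin-injective : ∀ {m n} (f g : Fin m → Fin n) → funToFin f ≡ funToFin g → ∀ i → f i ≡ g i
funToFin-injective f g e i = ≡.trans (≡.sym (Finₚ.finToFun-funToFin f i))
  (≡.trans (≡.cong (λ z → finToFun z i) e) (Finₚ.finToFun-funToFin g i))

_⊕_ : ∀ {a b c d} → a ≤ b → c ≤ d → a ℕ.+ c ≤ b ℕ.+ d
_⊕_ = ℕₚ.+-mono-≤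
infixl 5 _⊕_

-- Differences of kernel sequences

-- Estimates for a position y with K x + j = K′ y + j′, where K = k^i, K′ = k^i′ and κ = k^e,
-- κ′ = k^e′ satisfy K κ = K′ κ′.
module Positions {K K′ κ κ′ x y j j′ D : ℕ} .{{_ : NonZero K}} .{{_ : NonZero K′}}
  (lev : K ℕ.* κ ≡ K′ ℕ.* κ′) (pos : K ℕ.* x ℕ.+ j ≡ K′ ℕ.* y ℕ.+ j′) (j≤ : j ≤ D) (j′≤ : j′ ≤ D) where

  D≤KD : D ≤ K ℕ.* D
  D≤KD = ℕₚ.m≤n*m D K

  above-Reg : ∀ s → s ℕ.* κ ℕ.+ D ≤ x → s ℕ.* κ′ ≤ y
  above-Reg s h = ℕₚ.*-cancelˡ-≤ K′ (≤-linear (K′ ℕ.* (s ℕ.* κ′)) (K′ ℕ.* y) j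
    (ℕₚ.*-monoʳ-≤ K h ⊕ ℕₚ.≤-trans j′≤ D≤KD ⊕ ℕₚ.*-monoʳ-≤ s (ℕₚ.≤-reflexive (≡.sym lev)) ⊕ ℕₚ.≤-reflexive pos)
    (alg K K′ κ κ′ s D x y j j′))
    where
    alg : ∀ K K′ κ κ′ s D x y j j′ →
      K′ ℕ.* (s ℕ.* κ′) ℕ.+ (K ℕ.* x ℕ.+ K ℕ.* D ℕ.+ s ℕ.* (K ℕ.* κ) ℕ.+ (K′ ℕ.* y ℕ.+ j′)) ℕ.+ j
      ≡ K′ ℕ.* y ℕ.+ (K ℕ.* (s ℕ.* κ ℕ.+ D) ℕ.+ j′ ℕ.+ s ℕ.* (K′ ℕ.* κ′) ℕ.+ (K ℕ.* x ℕ.+ j))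
    alg = solve-∀

  below-Reg : ∀ s N → x ℕ.+ D ℕ.+ s ℕ.* κ ≤ N ℕ.* κ → y ℕ.+ s ℕ.* κ′ ≤ N ℕ.* κ′
  below-Reg s N h = ℕₚ.*-cancelˡ-≤ K′ (≤-linear (K′ ℕ.* (y ℕ.+ s ℕ.* κ′)) (K′ ℕ.* (N ℕ.* κ′)) j′
    (ℕₚ.*-monoʳ-≤ K h ⊕ ℕₚ.≤-trans j≤ D≤KD ⊕ ℕₚ.*-monoʳ-≤ s (ℕₚ.≤-reflexive (≡.sym lev))
      ⊕ ℕₚ.*-monoʳ-≤ N (ℕₚ.≤-reflexive lev) ⊕ ℕₚ.≤-reflexive (≡.sym pos))
    (alg K K′ κ κ′ s N D x y j j′))
    where
    alg : ∀ K K′ κ κ′ s N D x y j j′ →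
      K′ ℕ.* (y ℕ.+ s ℕ.* κ′) ℕ.+ (K ℕ.* (N ℕ.* κ) ℕ.+ K ℕ.* D ℕ.+ s ℕ.* (K ℕ.* κ) ℕ.+ N ℕ.* (K′ ℕ.* κ′) ℕ.+ (K ℕ.* x ℕ.+ j)) ℕ.+ j′
      ≡ K′ ℕ.* (N ℕ.* κ′) ℕ.+ (K ℕ.* (x ℕ.+ D ℕ.+ s ℕ.* κ) ℕ.+ j ℕ.+ s ℕ.* (K′ ℕ.* κ′) ℕ.+ N ℕ.* (K ℕ.* κ) ℕ.+ (K′ ℕ.* y ℕ.+ j′))
    alg = solve-∀

  -- Slack scales by `K` / `K′` ≤ 1/2, so `2 * G` at `x` becomes at most `G` at `y`.
  above-lower : 2 ℕ.* K ≤ K′ → ∀ C G → C ℕ.* κ ℕ.+ D ≤ x ℕ.+ 2 ℕ.* G → C ℕ.* κ′ ≤ y ℕ.+ G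
  above-lower h₂ C G h = ℕₚ.*-cancelˡ-≤ K′ (≤-linear (K′ ℕ.* (C ℕ.* κ′)) (K′ ℕ.* (y ℕ.+ G)) j
    (ℕₚ.*-monoʳ-≤ K h ⊕ ℕₚ.≤-trans j′≤ D≤KD ⊕ ℕₚ.*-monoʳ-≤ C (ℕₚ.≤-reflexive (≡.sym lev))
      ⊕ ℕₚ.≤-reflexive pos ⊕ ℕₚ.*-monoˡ-≤ G h₂)
    (alg K K′ κ κ′ C G D x y j j′))
    where
    alg : ∀ K K′ κ κ′ C G D x y j j′ →
      K′ ℕ.* (C ℕ.* κ′) ℕ.+ (K ℕ.* (x ℕ.+ 2 ℕ.* G) ℕ.+ K ℕ.* D ℕ.+ C ℕ.* (K ℕ.* κ) ℕ.+ (K′ ℕ.* y ℕ.+ j′) ℕ.+ K′ ℕ.* G) ℕ.+ j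
      ≡ K′ ℕ.* (y ℕ.+ G) ℕ.+ (K ℕ.* (C ℕ.* κ ℕ.+ D) ℕ.+ j′ ℕ.+ C ℕ.* (K′ ℕ.* κ′) ℕ.+ (K ℕ.* x ℕ.+ j) ℕ.+ 2 ℕ.* K ℕ.* G)
    alg = solve-∀

  -- The displacement `j` is at most `G`, so the slack `G` at `x` grows to at most `2 * G` before it
  -- is halved.
  below-lower : 2 ℕ.* K ≤ K′ → ∀ U G → D ≤ G → x ≤ U ℕ.* κ ℕ.+ G → y ≤ U ℕ.* κ′ ℕ.+ G
  below-lower h₂ U G D≤G h = ℕₚ.*-cancelˡ-≤ K′ (≤-linear (K′ ℕ.* y) (K′ ℕ.* (U ℕ.* κ′ ℕ.+ G)) j′
    (ℕₚ.*-monoʳ-≤ K h ⊕ ℕₚ.≤-trans j≤ (ℕₚ.≤-trans D≤KD (ℕₚ.*-monoʳ-≤ K D≤G))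
      ⊕ ℕₚ.*-monoʳ-≤ U (ℕₚ.≤-reflexive lev) ⊕ ℕₚ.≤-reflexive (≡.sym pos) ⊕ ℕₚ.*-monoˡ-≤ G h₂)
    (alg K K′ κ κ′ U G x y j j′))
    where
    alg : ∀ K K′ κ κ′ U G x y j j′ →
      K′ ℕ.* y ℕ.+ (K ℕ.* (U ℕ.* κ ℕ.+ G) ℕ.+ K ℕ.* G ℕ.+ U ℕ.* (K′ ℕ.* κ′) ℕ.+ (K ℕ.* x ℕ.+ j) ℕ.+ K′ ℕ.* G) ℕ.+ j′
      ≡ K′ ℕ.* (U ℕ.* κ′ ℕ.+ G) ℕ.+ (K ℕ.* x ℕ.+ j ℕ.+ U ℕ.* (K ℕ.* κ) ℕ.+ (K′ ℕ.* y ℕ.+ j′) ℕ.+ 2 ℕ.* K ℕ.* G)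
    alg = solve-∀

m∣n! : ∀ {m n} → 0 < m → m ≤ n → m ∣ n !
m∣n! {suc m} _ m≤n = ∣-trans (m∣m*n (m !)) (m≤n⇒m!∣n! m≤n)

module _ (k : ℕ) (2≤k : 2 ≤ k) (S : Shape) where
  open Terms k 2≤k
  open Shape S

  -- Kh bounds the number of values of h; a difference v of two values of h has at most Kh² values,
  -- so W bounds the number of windows of v of length D. Every period up to W divides M.
  module Constants (Kh : ℕ) where
    Kv W M G γ : ℕ
    Kv = Kh ℕ.* Kh
    W  = Kv ^ D
    M  = W !
    G  = 2 ℕ.* D ℕ.+ W
    γ  = 2 ℕ.* G ℕ.+ D

  -- Vanishing of `v` when a regular coefficient is preceded by coefficients killing `v`

  module ArrayLeaf {c ℓ} (R : CommutativeRing c ℓ) (Kh : ℕ) where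
    open CommutativeRing R
    open Sums R
    open Constants Kh
    open import Algebra.Properties.Ring ring using (x[y-z]≈xy-xz)
    open import Algebra.Properties.AbelianGroup +-abelianGroup using (x∙y⁻¹≈ε⇒x≈y; xyx⁻¹≈y)
    open import Algebra.Properties.Group +-group using (∙-cancelˡ; x≈y⇒x∙y⁻¹≈ε)

    infixr 8 _⨯_
    _⨯_ : ℕ → Carrier → Carrier
    n ⨯ y = fold 0# (y +_) n

    module _ (h : ℕ → ℕ → Carrier) (hl : ℕ → ℕ → Fin Kh)
      (hl-≈ : ∀ e x y → hl e x ≡ hl e y → h e x ≈ h e y) where

      v : ℕ → ℕ → Carrier
      v e x = h e (k ^ e ℕ.* M ℕ.+ x) - h e x

      vl : ℕ → ℕ → Fin Kv
      vl e x = combine (hl e (k ^ e ℕ.* M ℕ.+ x)) (hl e x)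

      vl-≈ : ∀ e x y → vl e x ≡ vl e y → v e x ≈ v e y
      vl-≈ e x y eq with Finₚ.combine-injective (hl e (k ^ e ℕ.* M ℕ.+ x)) (hl e x) _ _ eq
      ... | eq₁ , eq₂ = +-cong (hl-≈ e _ _ eq₁) (-‿cong (hl-≈ e x y eq₂))

      module _
        (torsionFree : ∀ n y → suc n ⨯ y ≈ 0# → y ≈ 0#)
        (P : Fin Q → Carrier)
        (eqn : ∀ E X → d ≤ E → D ≤ X → sum (λ q → P q * term 0# (v (E ∸ I q)) (I q) X (J q)) ≈ 0#)
        (N : ℕ) (start : ∀ e x → e < d → x ≤ N ℕ.* k ^ e → v e x ≈ 0#)
        (s U : ℕ) (U+C≤N : U ℕ.+ (s ℕ.+ γ) ≤ N) (C+2KM≤U : s ℕ.+ γ ℕ.+ 2 ℕ.* (Kh ℕ.* M) ≤ U)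
        (q : Fin Q)
        (kill : ∀ q′ → toℕ q′ < toℕ q → ∀ e x → s ℕ.* k ^ e ≤ x → x ℕ.+ s ℕ.* k ^ e ≤ N ℕ.* k ^ e → P q′ * v e x ≈ 0#)
        (cancel : ∀ y → P q * y ≈ 0# → y ≈ 0#)
        where

        C = s ℕ.+ γ
        i = I q
        j = J q

        -- The slack G does not grow with e: passing to a lower level divides positions by at least
        -- k ≥ 2, which absorbs the preperiod lost at each level.
        Inner : ℕ → ℕ → Set
        Inner e x = C ℕ.* k ^ e ≤ x ℕ.+ G × x ≤ U ℕ.* k ^ e ℕ.+ G

        module AtLevel (e : ℕ) (d≤e : d ≤ e) (IH : ∀ {e′} → e′ < e → ∀ x → Inner e′ x → v e′ x ≈ 0#) where
          κ = k ^ e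
          hi = U ℕ.* κ ℕ.+ G
          -- At this level of the equation the monomial `q` reads `v e`, and monomials with a larger
          -- `I` read lower levels.
          E = e ℕ.+ i

          γ≤γκ : γ ≤ γ ℕ.* κ
          γ≤γκ = ℕₚ.m≤m*n γ κ {{k^≢0 e}}

          -- Positions at which the recurrence is used. They start `D + W` before those of `Inner`,
          -- which leaves room for a preperiod of length up to `W`.
          Good : ℕ → Set
          Good x = C ℕ.* κ ℕ.+ D ≤ x ℕ.+ 2 ℕ.* G × x ≤ hi

          good-low : ∀ {x} → Good x → s ℕ.* κ ℕ.+ D ≤ x
          good-low {x} (p , _) = ≤-linear _ _ D (p ⊕ γ≤γκ) (alg s D G κ x)
            where
            alg : ∀ s D G κ x → s ℕ.* κ ℕ.+ D ℕ.+ (x ℕ.+ 2 ℕ.* G ℕ.+ (2 ℕ.* G ℕ.+ D) ℕ.* κ) ℕ.+ D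
              ≡ x ℕ.+ ((s ℕ.+ (2 ℕ.* G ℕ.+ D)) ℕ.* κ ℕ.+ D ℕ.+ (2 ℕ.* G ℕ.+ D))
            alg = solve-∀

          D≤x : ∀ {x} → Good x → D ≤ x
          D≤x g = ℕₚ.≤-trans (ℕₚ.m≤n+m D _) (good-low g)

          good-high : ∀ {x} → Good x → x ℕ.+ D ℕ.+ s ℕ.* κ ≤ N ℕ.* κ
          good-high {x} (_ , p) = ≤-linear _ _ G (p ⊕ γ≤γκ ⊕ ℕₚ.*-monoˡ-≤ κ U+C≤N) (alg s D G κ x U N)
            where
            alg : ∀ s D G κ x U N → x ℕ.+ D ℕ.+ s ℕ.* κ ℕ.+ (U ℕ.* κ ℕ.+ G ℕ.+ (2 ℕ.* G ℕ.+ D) ℕ.* κ ℕ.+ N ℕ.* κ) ℕ.+ G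
              ≡ N ℕ.* κ ℕ.+ (x ℕ.+ (2 ℕ.* G ℕ.+ D) ℕ.+ (U ℕ.+ (s ℕ.+ (2 ℕ.* G ℕ.+ D))) ℕ.* κ)
            alg = solve-∀

          level-eq : ∀ i′ → i′ ≤ E → k ^ i ℕ.* κ ≡ k ^ i′ ℕ.* k ^ (E ∸ i′)
          level-eq i′ i′≤E = begin
            k ^ i ℕ.* k ^ e          ≡⟨ ℕₚ.^-distribˡ-+-* k i e ⟨
            k ^ (i ℕ.+ e)            ≡⟨ ≡.cong (k ^_) (ℕₚ.+-comm i e) ⟩
            k ^ E                    ≡⟨ ≡.cong (k ^_) (ℕₚ.m+[n∸m]≡n i′≤E) ⟨
            k ^ (i′ ℕ.+ (E ∸ i′))    ≡⟨ ℕₚ.^-distribˡ-+-* k i′ (E ∸ i′) ⟩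
            k ^ i′ ℕ.* k ^ (E ∸ i′)  ∎
            where open ≡.≡-Reasoning

          I≤E : ∀ q′ → I q′ ≤ E
          I≤E q′ = ℕₚ.≤-trans (ℕₚ.<⇒≤ (I< q′)) (ℕₚ.≤-trans d≤e (ℕₚ.m≤m+n e i))

          summand : ℕ → Fin Q → Carrier
          summand x q′ = P q′ * term 0# (v (E ∸ I q′)) (I q′) (k ^ i ℕ.* x ℕ.+ j) (J q′)

          summand-q : ∀ x → summand x q ≈ P q * v e x
          summand-q x = *-congˡ (reflexive (≡.trans (term-hit i j ≡.refl) (≡.cong (λ a → v a x) (ℕₚ.m+n∸n≡m e i))))

          sum-eq : ∀ {x} → Good x → sum (summand x) ≈ 0#
          sum-eq {x} g = eqn E (k ^ i ℕ.* x ℕ.+ j) (ℕₚ.≤-trans d≤e (ℕₚ.m≤m+n e i))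
            (ℕₚ.≤-trans (D≤x g) (ℕₚ.≤-trans (ℕₚ.m≤n*m x (k ^ i) {{k^≢0 i}}) (ℕₚ.m≤m+n _ j)))

          -- Monomials before `q` have `I q′ ≤ i` and read level `e` or higher, out of reach of
          -- `IH`; `kill` is assumed on all levels for this reason.
          killed : ∀ {x} → Good x → ∀ q′ → toℕ q′ < toℕ q → summand x q′ ≈ 0#
          killed {x} g q′ lt = term-elim (λ y → P q′ * y ≈ 0#) (I q′) _ (J q′) hit (zeroʳ _)
            where
            hit : ∀ y → k ^ i ℕ.* x ℕ.+ j ≡ k ^ I q′ ℕ.* y ℕ.+ J q′ → P q′ * v (E ∸ I q′) y ≈ 0#
            hit y pos = kill q′ lt _ y (above-Reg s (good-low g)) (below-Reg s N (good-high g))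
              where open Positions {{k^≢0 i}} {{k^≢0 (I q′)}} (level-eq (I q′) (I≤E q′)) pos (J≤ q) (J≤ q′)

          lower-level : ∀ {x} → Good x → ∀ q′ → i < I q′ → summand x q′ ≈ 0#
          lower-level {x} (lo , up) q′ lt =
            trans (*-congˡ (term-elim (_≈ 0#) (I q′) _ (J q′) hit refl)) (zeroʳ _)
            where
            2K≤K′ : 2 ℕ.* k ^ i ≤ k ^ I q′
            2K≤K′ = ℕₚ.≤-trans (ℕₚ.*-monoˡ-≤ (k ^ i) 2≤k) (ℕₚ.^-monoʳ-≤ k lt)
            E∸I<e : E ∸ I q′ < e
            E∸I<e = ℕₚ.+-cancelʳ-< (I q′) _ _ (≡.subst (_< e ℕ.+ I q′) (≡.sym (ℕₚ.m∸n+n≡m (I≤E q′))) (ℕₚ.+-monoʳ-< e lt))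
            D≤G : D ≤ G
            D≤G = ℕₚ.≤-trans (ℕₚ.m≤n*m D 2) (ℕₚ.m≤m+n _ W)
            hit : ∀ y → k ^ i ℕ.* x ℕ.+ j ≡ k ^ I q′ ℕ.* y ℕ.+ J q′ → v (E ∸ I q′) y ≈ 0#
            hit y pos = IH E∸I<e y (above-lower 2K≤K′ C G lo , below-lower 2K≤K′ U G D≤G up)
              where open Positions {{k^≢0 i}} {{k^≢0 (I q′)}} (level-eq (I q′) (I≤E q′)) pos (J≤ q) (J≤ q′)

          -- In the difference of the equations at `x` and `p + x`, earlier terms are killed and
          -- lower levels vanish by `IH`. What remains besides `q` has the same `i` and a larger
          -- exponent, and reads `v e` only at the `D` positions before `x`. Then `P q` is
          -- cancelled.
          deterministic : ∀ {x} p → Good x → Good (p ℕ.+ x) →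
            (∀ y → y < x → x ≤ y ℕ.+ D → v e y ≈ v e (p ℕ.+ y)) → v e x ≈ v e (p ℕ.+ x)
          deterministic {x} p g g′ prev = x∙y⁻¹≈ε⇒x≈y _ _ (cancel _ (begin
            P q * (v e x - v e (p ℕ.+ x))              ≈⟨ x[y-z]≈xy-xz _ _ _ ⟩
            P q * v e x - P q * v e (p ℕ.+ x)          ≈⟨ +-cong (summand-q x) (-‿cong (summand-q (p ℕ.+ x))) ⟨
            summand x q - summand (p ℕ.+ x) q          ≈⟨ isolate (λ q′ → summand x q′ - summand (p ℕ.+ x) q′) q total others ⟩
            0#                                         ∎))
            where
            open import Relation.Binary.Reasoning.Setoid setoid
            total : sum (λ q′ → summand x q′ - summand (p ℕ.+ x) q′) ≈ 0#
            total = trans (sum-sub (summand x) (summand (p ℕ.+ x)))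
              (trans (+-cong (sum-eq g) (-‿cong (sum-eq g′))) (-‿inverseʳ 0#))
            both0 : ∀ q′ → summand x q′ ≈ 0# → summand (p ℕ.+ x) q′ ≈ 0# → summand x q′ - summand (p ℕ.+ x) q′ ≈ 0#
            both0 q′ a b = trans (+-cong a (-‿cong b)) (-‿inverseʳ 0#)
            same-level : ∀ q′ → I q′ ≡ i → j < J q′ → summand x q′ ≈ summand (p ℕ.+ x) q′
            same-level q′ I≡ j< = *-congˡ (trans hit
              -- Here `term-shift` is taken at the level `I q′` itself, so the position read moves
              -- by exactly `p`.
              (reflexive (≡.sym (≡.trans (≡.cong (λ a → term 0# (v (E ∸ I q′)) (I q′) a (J q′)) shift-pos)
                (term-shift p (I q′) (J q′) ℕₚ.≤-refl J≤X)))))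
              where
              X = k ^ i ℕ.* x ℕ.+ j
              E∸ : E ∸ I q′ ≡ e
              E∸ = ≡.trans (≡.cong (E ∸_) I≡) (ℕₚ.m+n∸n≡m e i)
              alg : ∀ K p x j → K ℕ.* (p ℕ.+ x) ℕ.+ j ≡ K ℕ.* p ℕ.+ (K ℕ.* x ℕ.+ j)
              alg = solve-∀
              shift-pos : k ^ i ℕ.* (p ℕ.+ x) ℕ.+ j ≡ k ^ I q′ ℕ.* p ℕ.+ X
              shift-pos = ≡.trans (alg (k ^ i) p x j) (≡.cong (λ a → k ^ a ℕ.* p ℕ.+ X) (≡.sym I≡))
              J≤X : J q′ ≤ X
              J≤X = ℕₚ.≤-trans (J≤ q′) (ℕₚ.≤-trans (D≤x g) (ℕₚ.≤-trans (ℕₚ.m≤n*m x (k ^ i) {{k^≢0 i}}) (ℕₚ.m≤m+n _ j)))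
              hit : term 0# (v (E ∸ I q′)) (I q′) X (J q′) ≈
                    term 0# (λ y → v (E ∸ I q′) (k ^ (I q′ ∸ I q′) ℕ.* p ℕ.+ y)) (I q′) X (J q′)
              hit = term-rel _≈_ (I q′) X (J q′) value refl
                where
                value : ∀ y → X ≡ k ^ I q′ ℕ.* y ℕ.+ J q′ → v (E ∸ I q′) y ≈ v (E ∸ I q′) (k ^ (I q′ ∸ I q′) ℕ.* p ℕ.+ y)
                value y pos = begin
                  v (E ∸ I q′) y                                        ≈⟨ reflexive (≡.cong (λ a → v a y) E∸) ⟩
                  v e y                                                 ≈⟨ prev y y<x x≤y+D ⟩
                  v e (p ℕ.+ y)                                         ≈⟨ reflexive (≡.cong₂ v E∸ p≡) ⟨
                  v (E ∸ I q′) (k ^ (I q′ ∸ I q′) ℕ.* p ℕ.+ y)          ∎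
                  where
                  p≡ : k ^ (I q′ ∸ I q′) ℕ.* p ℕ.+ y ≡ p ℕ.+ y
                  p≡ = ≡.cong (ℕ._+ y) (≡.trans (≡.cong (λ a → k ^ a ℕ.* p) (ℕₚ.n∸n≡0 (I q′))) (ℕₚ.*-identityˡ p))
                  pos′ : k ^ i ℕ.* x ℕ.+ j ≡ k ^ i ℕ.* y ℕ.+ J q′
                  pos′ = ≡.trans pos (≡.cong (λ a → k ^ a ℕ.* y ℕ.+ J q′) I≡)
                  y<x : y < x
                  y<x = ℕₚ.*-cancelˡ-< (k ^ i) y x (≤-linear _ _ 0 (j< ⊕ ℕₚ.≤-reflexive (≡.sym pos′)) (alg′ (k ^ i ℕ.* y) (k ^ i ℕ.* x) j (J q′)))
                    where
                    alg′ : ∀ a b j j′ → suc a ℕ.+ (j′ ℕ.+ (b ℕ.+ j)) ℕ.+ 0 ≡ b ℕ.+ (suc j ℕ.+ (a ℕ.+ j′))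
                    alg′ = solve-∀
                  x≤y+D : x ≤ y ℕ.+ D
                  x≤y+D = ℕₚ.*-cancelˡ-≤ (k ^ i) {{k^≢0 i}} (≤-linear _ _ j
                    (ℕₚ.≤-trans (J≤ q′) (ℕₚ.m≤n*m D (k ^ i) {{k^≢0 i}}) ⊕ ℕₚ.≤-reflexive pos′) (alg′ (k ^ i) x y j (J q′) D))
                    where
                    alg′ : ∀ K x y j j′ D → K ℕ.* x ℕ.+ (K ℕ.* D ℕ.+ (K ℕ.* y ℕ.+ j′)) ℕ.+ j ≡ K ℕ.* (y ℕ.+ D) ℕ.+ (j′ ℕ.+ (K ℕ.* x ℕ.+ j))
                    alg′ = solve-∀
            others : ∀ q′ → q′ ≢ q → summand x q′ - summand (p ℕ.+ x) q′ ≈ 0#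
            others q′ ne with ℕₚ.<-cmp (toℕ q′) (toℕ q)
            ... | tri< lt _ _ = both0 q′ (killed g q′ lt) (killed g′ q′ lt)
            ... | tri≈ _ eq _ = ⊥-elim (ne (Finₚ.toℕ-injective eq))
            ... | tri> _ _ gt with lex gt
            ...   | inj₁ i<        = both0 q′ (lower-level g q′ i<) (lower-level g′ q′ i<)
            ...   | inj₂ (i≡ , j<) = x≈y⇒x∙y⁻¹≈ε (same-level q′ (≡.sym i≡) j<)

          2G≤ : 2 ℕ.* G ≤ C ℕ.* κ ℕ.+ D
          2G≤ = ≤-linear _ _ (s ℕ.* κ ℕ.+ D ℕ.+ D) γ≤γκ (alg s D G κ)
            where
            alg : ∀ s D G κ → 2 ℕ.* G ℕ.+ (2 ℕ.* G ℕ.+ D) ℕ.* κ ℕ.+ (s ℕ.* κ ℕ.+ D ℕ.+ D)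
              ≡ (s ℕ.+ (2 ℕ.* G ℕ.+ D)) ℕ.* κ ℕ.+ D ℕ.+ (2 ℕ.* G ℕ.+ D)
            alg = solve-∀

          lo : ℕ
          lo = (C ℕ.* κ ℕ.+ D) ∸ 2 ℕ.* G

          lo+2G : lo ℕ.+ 2 ℕ.* G ≡ C ℕ.* κ ℕ.+ D
          lo+2G = ℕₚ.m∸n+n≡m 2G≤

          window : Fin (suc W) → Fin W
          window a = funToFin (λ (l : Fin D) → vl e (toℕ l ℕ.+ (toℕ a ℕ.+ lo)))

          -- There are `suc W` windows but only `W` codes, so two windows coincide, both starting at
          -- most `W` after `lo`.
          repetition : ∃ λ a → ∃ λ p → a ≤ W × 0 < p × p ≤ W ×
            (∀ l → l < D → v e (l ℕ.+ (a ℕ.+ lo)) ≈ v e (p ℕ.+ (l ℕ.+ (a ℕ.+ lo))))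
          repetition with Finₚ.pigeonhole (ℕₚ.n<1+n W) window
          ... | a₁ , a₂ , a₁<a₂ , same = toℕ a₁ , toℕ a₂ ∸ toℕ a₁ , ℕₚ.≤-pred (Finₚ.toℕ<n a₁) , ℕₚ.m<n⇒0<n∸m a₁<a₂
              , ℕₚ.≤-trans (ℕₚ.m∸n≤m (toℕ a₂) (toℕ a₁)) (ℕₚ.≤-pred (Finₚ.toℕ<n a₂)) , agree
            where
            alg : ∀ l p a b → l ℕ.+ (p ℕ.+ a ℕ.+ b) ≡ p ℕ.+ (l ℕ.+ (a ℕ.+ b))
            alg = solve-∀
            agree : ∀ l → l < D → v e (l ℕ.+ (toℕ a₁ ℕ.+ lo)) ≈ v e (toℕ a₂ ∸ toℕ a₁ ℕ.+ (l ℕ.+ (toℕ a₁ ℕ.+ lo)))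
            agree l l<D = trans (vl-≈ e _ _ (≡.subst (λ z → vl e (z ℕ.+ (toℕ a₁ ℕ.+ lo)) ≡ vl e (z ℕ.+ (toℕ a₂ ℕ.+ lo)))
                (Finₚ.toℕ-fromℕ< l<D) (funToFin-injective _ _ same (fromℕ< l<D))))
              (reflexive (≡.cong (v e) (≡.trans (≡.cong (λ z → l ℕ.+ (z ℕ.+ lo)) (≡.sym (ℕₚ.m∸n+n≡m (ℕₚ.<⇒≤ a₁<a₂))))
                (alg l _ (toℕ a₁) lo))))

          L : ℕ
          L = κ ℕ.* M

          -- By `deterministic` the repetition propagates as a period `p ≤ W`. Whatever `p` was
          -- found, it divides `W !` and hence `L`.
          periodic : ∀ x → C ℕ.* κ ≤ x ℕ.+ G → L ℕ.+ x ≤ hi → v e x ≈ v e (L ℕ.+ x)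
          periodic x C≤ L≤ with repetition
          ... | a , p , a≤W , 0<p , p≤W , agree = conclude (m∣n! 0<p p≤W)
            where
            onestep : ∀ x → a ℕ.+ lo ≤ x → p ℕ.+ x ≤ hi → v e x ≈ v e (p ℕ.+ x)
            onestep = <-rec _ rec
              where
              rec : ∀ x → (∀ {y} → y < x → a ℕ.+ lo ≤ y → p ℕ.+ y ≤ hi → v e y ≈ v e (p ℕ.+ y)) →
                    a ℕ.+ lo ≤ x → p ℕ.+ x ≤ hi → v e x ≈ v e (p ℕ.+ x)
              rec x ih a+lo≤x p+x≤hi with (x ∸ (a ℕ.+ lo)) ℕ.<? D
              ... | yes l<D = ≡.subst (λ z → v e z ≈ v e (p ℕ.+ z)) (ℕₚ.m∸n+n≡m a+lo≤x) (agree _ l<D)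
              ... | no ¬l<D = deterministic p
                  (low x (ℕₚ.≤-trans (ℕₚ.m≤n+m lo a) a+lo≤x) , ℕₚ.≤-trans (ℕₚ.m≤n+m x p) p+x≤hi)
                  (low (p ℕ.+ x) (ℕₚ.≤-trans (ℕₚ.m≤n+m lo a) (ℕₚ.≤-trans a+lo≤x (ℕₚ.m≤n+m x p))) , p+x≤hi)
                  (λ y y<x x≤y+D → ih y<x (ℕₚ.+-cancelʳ-≤ D _ _ (ℕₚ.≤-trans a+lo+D≤x x≤y+D))
                    (ℕₚ.≤-trans (ℕₚ.+-monoʳ-≤ p (ℕₚ.<⇒≤ y<x)) p+x≤hi))
                where
                a+lo+D≤x : a ℕ.+ lo ℕ.+ D ≤ x
                a+lo+D≤x = ≡.subst (a ℕ.+ lo ℕ.+ D ≤_) (ℕₚ.m+[n∸m]≡n a+lo≤x) (ℕₚ.+-monoʳ-≤ (a ℕ.+ lo) (ℕₚ.≮⇒≥ ¬l<D))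
                low : ∀ x → lo ≤ x → C ℕ.* κ ℕ.+ D ≤ x ℕ.+ 2 ℕ.* G
                low x lo≤x = ≡.subst (_≤ x ℕ.+ 2 ℕ.* G) lo+2G (ℕₚ.+-monoˡ-≤ (2 ℕ.* G) lo≤x)
            a+lo≤x : a ℕ.+ lo ≤ x
            a+lo≤x = ≤-linear _ _ D (a≤W ⊕ ℕₚ.≤-reflexive lo+2G ⊕ C≤) (alg a lo x W D C κ)
              where
              alg : ∀ a lo x W D C κ → a ℕ.+ lo ℕ.+ (W ℕ.+ (C ℕ.* κ ℕ.+ D) ℕ.+ (x ℕ.+ (2 ℕ.* D ℕ.+ W))) ℕ.+ D
                ≡ x ℕ.+ (a ℕ.+ (lo ℕ.+ 2 ℕ.* (2 ℕ.* D ℕ.+ W)) ℕ.+ C ℕ.* κ)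
              alg = solve-∀
            many : ∀ t → t ℕ.* p ℕ.+ x ≤ hi → v e x ≈ v e (t ℕ.* p ℕ.+ x)
            many zero    _ = refl
            many (suc t) b = trans (many t (ℕₚ.≤-trans (ℕₚ.m≤n+m _ p) b′))
              (trans (onestep (t ℕ.* p ℕ.+ x) (ℕₚ.≤-trans a+lo≤x (ℕₚ.m≤n+m x _)) b′)
                     (reflexive (≡.cong (v e) (≡.sym (ℕₚ.+-assoc p (t ℕ.* p) x)))))
              where
              b′ : p ℕ.+ (t ℕ.* p ℕ.+ x) ≤ hi
              b′ = ≡.subst (_≤ hi) (ℕₚ.+-assoc p (t ℕ.* p) x) b
            conclude : p ∣ M → v e x ≈ v e (L ℕ.+ x)
            conclude (divides t M≡) = ≡.subst (λ z → v e x ≈ v e (z ℕ.+ x)) (≡.sym L≡)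
              (many (κ ℕ.* t) (≡.subst (λ z → z ℕ.+ x ≤ hi) L≡ L≤))
              where
              L≡ : L ≡ κ ℕ.* t ℕ.* p
              L≡ = ≡.trans (≡.cong (κ ℕ.*_) M≡) (≡.sym (ℕₚ.*-assoc κ t p))

          module Progression (β : ℕ) (β-low : C ℕ.* κ ≤ β ℕ.+ G) (β-high : Kh ℕ.* L ℕ.+ β ≤ hi) where

            constant : ∀ t → t ≤ Kh → v e β ≈ v e (t ℕ.* L ℕ.+ β)
            constant zero    _ = refl
            constant (suc t) b = trans (constant t (ℕₚ.<⇒≤ b))
              (trans (periodic (t ℕ.* L ℕ.+ β) (ℕₚ.≤-trans β-low (ℕₚ.+-monoˡ-≤ G (ℕₚ.m≤n+m β (t ℕ.* L))))
                       (≡.subst (_≤ hi) (ℕₚ.+-assoc L (t ℕ.* L) β) (ℕₚ.≤-trans (ℕₚ.+-monoˡ-≤ β (ℕₚ.*-monoˡ-≤ L b)) β-high)))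
                     (reflexive (≡.cong (v e) (≡.sym (ℕₚ.+-assoc L (t ℕ.* L) β)))))

            step : ∀ t → t < Kh → h e (suc t ℕ.* L ℕ.+ β) ≈ h e (t ℕ.* L ℕ.+ β) + v e β
            step t b = begin
              h e (suc t ℕ.* L ℕ.+ β)                                ≈⟨ reflexive (≡.cong (h e) (ℕₚ.+-assoc L (t ℕ.* L) β)) ⟩
              h e (L ℕ.+ (t ℕ.* L ℕ.+ β))                            ≈⟨ xyx⁻¹≈y _ _ ⟨
              h e (t ℕ.* L ℕ.+ β) + h e (L ℕ.+ (t ℕ.* L ℕ.+ β)) - h e (t ℕ.* L ℕ.+ β)  ≈⟨ +-assoc _ _ _ ⟩
              h e (t ℕ.* L ℕ.+ β) + v e (t ℕ.* L ℕ.+ β)              ≈⟨ +-congˡ (constant t (ℕₚ.<⇒≤ b)) ⟨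
              h e (t ℕ.* L ℕ.+ β) + v e β                            ∎
              where open import Relation.Binary.Reasoning.Setoid setoid

            steps : ∀ g t → g ℕ.+ t ≤ Kh → h e ((g ℕ.+ t) ℕ.* L ℕ.+ β) ≈ h e (t ℕ.* L ℕ.+ β) + g ⨯ v e β
            steps zero    t b = sym (+-identityʳ _)
            steps (suc g) t b = begin
              h e ((suc g ℕ.+ t) ℕ.* L ℕ.+ β)               ≈⟨ step (g ℕ.+ t) b ⟩
              h e ((g ℕ.+ t) ℕ.* L ℕ.+ β) + v e β           ≈⟨ +-congʳ (steps g t (ℕₚ.<⇒≤ b)) ⟩
              h e (t ℕ.* L ℕ.+ β) + g ⨯ v e β + v e β       ≈⟨ +-assoc _ _ _ ⟩
              h e (t ℕ.* L ℕ.+ β) + (g ⨯ v e β + v e β)     ≈⟨ +-congˡ (+-comm _ _) ⟩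
              h e (t ℕ.* L ℕ.+ β) + suc g ⨯ v e β           ∎
              where open import Relation.Binary.Reasoning.Setoid setoid

            -- an arithmetic progression with finitely many values is constant
            vanishes : v e β ≈ 0#
            vanishes with Finₚ.pigeonhole (ℕₚ.n<1+n Kh) (λ t → hl e (toℕ t ℕ.* L ℕ.+ β))
            ... | t₁ , t₂ , t₁<t₂ , same = torsion (ℕₚ.m<n⇒0<n∸m t₁<t₂) (∙-cancelˡ (h e (toℕ t₁ ℕ.* L ℕ.+ β)) _ _ (begin
                h e (toℕ t₁ ℕ.* L ℕ.+ β) + (toℕ t₂ ∸ toℕ t₁) ⨯ v e β     ≈⟨ steps (toℕ t₂ ∸ toℕ t₁) (toℕ t₁) (≡.subst (_≤ Kh) (≡.sym t₂≡) (ℕₚ.≤-pred (Finₚ.toℕ<n t₂))) ⟨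
                h e ((toℕ t₂ ∸ toℕ t₁ ℕ.+ toℕ t₁) ℕ.* L ℕ.+ β)          ≈⟨ reflexive (≡.cong (λ z → h e (z ℕ.* L ℕ.+ β)) t₂≡) ⟩
                h e (toℕ t₂ ℕ.* L ℕ.+ β)                                ≈⟨ hl-≈ e _ _ same ⟨
                h e (toℕ t₁ ℕ.* L ℕ.+ β)                                ≈⟨ +-identityʳ _ ⟨
                h e (toℕ t₁ ℕ.* L ℕ.+ β) + 0#                           ∎))
              where
              open import Relation.Binary.Reasoning.Setoid setoid
              t₂≡ : toℕ t₂ ∸ toℕ t₁ ℕ.+ toℕ t₁ ≡ toℕ t₂
              t₂≡ = ℕₚ.m∸n+n≡m (ℕₚ.<⇒≤ t₁<t₂)
              torsion : ∀ {g} → 0 < g → g ⨯ v e β ≈ 0# → v e β ≈ 0#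
              torsion {suc g} _ = torsionFree g (v e β)

          conclusion : ∀ x → Inner e x → v e x ≈ 0#
          conclusion x (x-low , x-high) with (Kh ℕ.* L ℕ.+ x) ℕ.≤? hi
          ... | yes b = Progression.vanishes x x-low b
          -- Too close to the upper end, the progression is made to end at `x`; `v e` is constant
          -- along it, and `C+2KM≤U` provides the length.
          ... | no ¬b = trans (reflexive (≡.cong (v e) (≡.sym x≡))) (trans (sym (constant Kh ℕₚ.≤-refl)) vanishes)
            where
            hi<  : hi < Kh ℕ.* L ℕ.+ x
            hi< = ℕₚ.≰⇒> ¬b
            room : (C ℕ.+ 2 ℕ.* (Kh ℕ.* M)) ℕ.* κ ≤ U ℕ.* κ
            room = ℕₚ.*-monoˡ-≤ κ C+2KM≤U
            KL≤x : Kh ℕ.* L ≤ x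
            KL≤x = ≤-linear _ _ (suc (C ℕ.* κ ℕ.+ G)) (hi< ⊕ room) (alg Kh κ M C U G x)
              where
              alg : ∀ Kh κ M C U G x → Kh ℕ.* (κ ℕ.* M) ℕ.+ (Kh ℕ.* (κ ℕ.* M) ℕ.+ x ℕ.+ U ℕ.* κ) ℕ.+ suc (C ℕ.* κ ℕ.+ G)
                ≡ x ℕ.+ (suc (U ℕ.* κ ℕ.+ G) ℕ.+ (C ℕ.+ 2 ℕ.* (Kh ℕ.* M)) ℕ.* κ)
              alg = solve-∀
            β = x ∸ Kh ℕ.* L
            x≡ : Kh ℕ.* L ℕ.+ β ≡ x
            x≡ = ℕₚ.m+[n∸m]≡n KL≤x
            β-low : C ℕ.* κ ≤ β ℕ.+ G
            β-low = ≤-linear _ _ (suc (2 ℕ.* G)) (hi< ⊕ room ⊕ ℕₚ.≤-reflexive (≡.sym x≡)) (alg Kh κ M C U G x β)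
              where
              alg : ∀ Kh κ M C U G x β → C ℕ.* κ ℕ.+ (Kh ℕ.* (κ ℕ.* M) ℕ.+ x ℕ.+ U ℕ.* κ ℕ.+ (Kh ℕ.* (κ ℕ.* M) ℕ.+ β)) ℕ.+ suc (2 ℕ.* G)
                ≡ β ℕ.+ G ℕ.+ (suc (U ℕ.* κ ℕ.+ G) ℕ.+ (C ℕ.+ 2 ℕ.* (Kh ℕ.* M)) ℕ.* κ ℕ.+ x)
              alg = solve-∀
            open Progression β β-low (≡.subst (_≤ hi) (≡.sym x≡) x-high)

        leaf : ∀ e x → Inner e x → v e x ≈ 0#
        leaf = <-rec (λ e → ∀ x → Inner e x → v e x ≈ 0#) step
          where
          step : ∀ e → (∀ {e′} → e′ < e → ∀ x → Inner e′ x → v e′ x ≈ 0#) → ∀ x → Inner e x → v e x ≈ 0#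
          step e IH x inn with e ℕ.<? d
          ... | no e≮d = AtLevel.conclusion e (ℕₚ.≮⇒≥ e≮d) IH x inn
          ... | yes e<d = start e x e<d (≤-linear _ _ (G ℕ.+ D ℕ.+ s ℕ.* k ^ e)
              (proj₂ inn ⊕ ℕₚ.m≤m*n γ (k ^ e) {{k^≢0 e}} ⊕ ℕₚ.*-monoˡ-≤ (k ^ e) U+C≤N) (alg x U (k ^ e) G D s N))
            where
            alg : ∀ x U κ G D s N → x ℕ.+ (U ℕ.* κ ℕ.+ G ℕ.+ (2 ℕ.* G ℕ.+ D) ℕ.* κ ℕ.+ N ℕ.* κ) ℕ.+ (G ℕ.+ D ℕ.+ s ℕ.* κ)
              ≡ N ℕ.* κ ℕ.+ (x ℕ.+ (2 ℕ.* G ℕ.+ D) ℕ.+ (U ℕ.+ (s ℕ.+ (2 ℕ.* G ℕ.+ D))) ℕ.* κ)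
            alg = solve-∀

-- Contexts and translation by `M`

module _ (k : ℕ) (2≤k : 2 ≤ k) (S : Shape) where
  open Terms k 2≤k
  open Shape S

  module Context (q₀ : Fin Q) (m : ℕ) where
    Kh = m ℕ.* m
    open Constants k 2≤k S Kh public
    depth₀ N offset width : ℕ
    depth₀ = depth Kv (toℕ q₀)
    -- The shrinkings lose `offset` at either end, `2 * (Kh * M)` leaves room for the progressions,
    -- and the final 1 for one block of length `k ^ e` after `offset`.
    N      = 2 ℕ.* (depth₀ ℕ.* γ) ℕ.+ 2 ℕ.* (Kh ℕ.* M) ℕ.+ 1
    offset = depth₀ ℕ.* γ
    -- Evaluating `v` up to `N * k ^ e` reads a further `k ^ e * M` positions, at levels `e < d`.
    width  = (N ℕ.+ M) ℕ.* k ^ d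

    contexts : ℕ
    contexts = (m ^ suc width) ^ d

    row : (ℕ → Fin m) → ℕ → ℕ → Fin (suc width) → Fin m
    row α n e x = α (k ^ e ℕ.* n ℕ.+ toℕ x)

    -- Recording labels instead of values makes equality of contexts decidable.
    context : (ℕ → Fin m) → ℕ → Fin contexts
    context α n = funToFin (λ (e : Fin d) → funToFin (row α n (toℕ e)))

    context-≡ : ∀ α n n′ → context α n ≡ context α n′ → ∀ e x → e < d → x ≤ width →
      α (k ^ e ℕ.* n ℕ.+ x) ≡ α (k ^ e ℕ.* n′ ℕ.+ x)
    context-≡ α n n′ eq e x e<d x≤w =
      ≡.subst₂ (λ e x → α (k ^ e ℕ.* n ℕ.+ x) ≡ α (k ^ e ℕ.* n′ ℕ.+ x))
        (Finₚ.toℕ-fromℕ< e<d) (Finₚ.toℕ-fromℕ< (s≤s x≤w))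
        (funToFin-injective (row α n (toℕ (fromℕ< e<d))) (row α n′ (toℕ (fromℕ< e<d)))
          (funToFin-injective (λ (e : Fin d) → funToFin (row α n (toℕ e))) _ eq (fromℕ< e<d)) (fromℕ< (s≤s x≤w)))

  module Translation {c ℓ} (R : CommutativeRing c ℓ) where
    open CommutativeRing R
    open Sums R

    module _
      (natInverse : ∀ n → ∃ λ y → y * fold 0# (1# +_) (suc n) ≈ 1#)
      (P : Fin Q → Carrier) (q₀ : Fin Q) (u : Carrier) (u-inv : P q₀ * u ≈ 1#)
      (m : ℕ) (val : Fin m → Carrier) (α : ℕ → Fin m)
      (eqn : ∀ N → sum (λ q → P q * term 0# (val ∘ α) (I q) N (J q)) ≈ 0#)
      where

      open Ideals R
      open Context q₀ m

      fold-* : ∀ n y → fold 0# (1# +_) n * y ≈ fold 0# (y +_) n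
      fold-* zero    y = zeroˡ y
      fold-* (suc n) y = trans (distribʳ y 1# _) (+-cong (*-identityˡ y) (fold-* n y))

      module Pair (n n′ : ℕ) (same : context α n ≡ context α n′) where

        h : ℕ → ℕ → Carrier
        h e x = val (α (k ^ e ℕ.* n ℕ.+ x)) - val (α (k ^ e ℕ.* n′ ℕ.+ x))

        hl : ℕ → ℕ → Fin Kh
        hl e x = combine (α (k ^ e ℕ.* n ℕ.+ x)) (α (k ^ e ℕ.* n′ ℕ.+ x))

        hl-≈ : ∀ e x y → hl e x ≡ hl e y → h e x ≈ h e y
        hl-≈ e x y eq with Finₚ.combine-injective (α (k ^ e ℕ.* n ℕ.+ x)) (α (k ^ e ℕ.* n′ ℕ.+ x)) _ _ eq
        ... | eq₁ , eq₂ = +-cong (reflexive (≡.cong val eq₁)) (-‿cong (reflexive (≡.cong val eq₂)))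

        open ArrayLeaf k 2≤k S R Kh using (v; vl)

        V : ℕ → ℕ → Carrier
        V = v h hl hl-≈

        J≤X : ∀ {X} → D ≤ X → ∀ q → J q ≤ X
        J≤X D≤X q = ℕₚ.≤-trans (J≤ q) D≤X

        -- The difference of the equations at `k ^ E * n + X` and `k ^ E * n′ + X`; the bounds on
        -- `E` and `X` let `term-shift` apply to every monomial.
        eqn-h : ∀ E X → d ≤ E → D ≤ X → sum (λ q → P q * term 0# (h (E ∸ I q)) (I q) X (J q)) ≈ 0#
        eqn-h E X d≤E D≤X = weighted-sub P _ _ _
          (λ q → trans (split q) (sym (+-cong (shift n q) (-‿cong (shift n′ q)))))
          (eqn (k ^ E ℕ.* n ℕ.+ X)) (eqn (k ^ E ℕ.* n′ ℕ.+ X))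
          where
          shift : ∀ n q → term 0# (val ∘ α) (I q) (k ^ E ℕ.* n ℕ.+ X) (J q) ≈
                          term 0# (λ y → val (α (k ^ (E ∸ I q) ℕ.* n ℕ.+ y))) (I q) X (J q)
          shift n q = reflexive (term-shift n (I q) (J q) (ℕₚ.≤-trans (ℕₚ.<⇒≤ (I< q)) d≤E) (J≤X D≤X q))
          split : ∀ q → term 0# (h (E ∸ I q)) (I q) X (J q) ≈
            term 0# (λ y → val (α (k ^ (E ∸ I q) ℕ.* n ℕ.+ y))) (I q) X (J q) -
            term 0# (λ y → val (α (k ^ (E ∸ I q) ℕ.* n′ ℕ.+ y))) (I q) X (J q)
          split q with hit? (I q) X (J q)
          ... | yes _ = refl
          ... | no _  = sym (-‿inverseʳ 0#)

        eqn-v : ∀ E X → d ≤ E → D ≤ X → sum (λ q → P q * term 0# (V (E ∸ I q)) (I q) X (J q)) ≈ 0#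
        eqn-v E X d≤E D≤X = weighted-sub P _ _ _
          (λ q → trans (split q) (sym (+-congʳ (shift q))))
          (eqn-h E (k ^ E ℕ.* M ℕ.+ X) d≤E (ℕₚ.≤-trans D≤X (ℕₚ.m≤n+m X _))) (eqn-h E X d≤E D≤X)
          where
          shift : ∀ q → term 0# (h (E ∸ I q)) (I q) (k ^ E ℕ.* M ℕ.+ X) (J q) ≈
                        term 0# (λ y → h (E ∸ I q) (k ^ (E ∸ I q) ℕ.* M ℕ.+ y)) (I q) X (J q)
          shift q = reflexive (term-shift M (I q) (J q) (ℕₚ.≤-trans (ℕₚ.<⇒≤ (I< q)) d≤E) (J≤X D≤X q))
          split : ∀ q → term 0# (V (E ∸ I q)) (I q) X (J q) ≈
            term 0# (λ y → h (E ∸ I q) (k ^ (E ∸ I q) ℕ.* M ℕ.+ y)) (I q) X (J q) -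
            term 0# (h (E ∸ I q)) (I q) X (J q)
          split q with hit? (I q) X (J q)
          ... | yes _ = refl
          ... | no _  = sym (-‿inverseʳ 0#)

        start : ∀ e x → e < d → x ≤ N ℕ.* k ^ e → V e x ≈ 0#
        start e x e<d x≤ = trans (+-cong (zero-h (k ^ e ℕ.* M ℕ.+ x) (begin
            k ^ e ℕ.* M ℕ.+ x              ≤⟨ ℕₚ.+-monoʳ-≤ _ x≤ ⟩
            k ^ e ℕ.* M ℕ.+ N ℕ.* k ^ e    ≡⟨ alg (k ^ e) M N ⟩
            (N ℕ.+ M) ℕ.* k ^ e            ≤⟨ mono ⟩
            width                          ∎))
          (-‿cong (zero-h x (ℕₚ.≤-trans x≤ (ℕₚ.≤-trans (ℕₚ.*-monoˡ-≤ (k ^ e) (ℕₚ.m≤m+n N M)) mono)))))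
          (-‿inverseʳ 0#)
          where
          open ℕₚ.≤-Reasoning
          alg : ∀ a M N → a ℕ.* M ℕ.+ N ℕ.* a ≡ (N ℕ.+ M) ℕ.* a
          alg = solve-∀
          mono : (N ℕ.+ M) ℕ.* k ^ e ≤ width
          mono = ℕₚ.*-monoʳ-≤ (N ℕ.+ M) (ℕₚ.^-monoʳ-≤ k (ℕₚ.<⇒≤ e<d))
          zero-h : ∀ y → y ≤ width → h e y ≈ 0#
          zero-h y y≤ = trans (+-congʳ (reflexive (≡.cong val (context-≡ α n n′ same e y e<d y≤)))) (-‿inverseʳ _)

        -- Each shrinking removes `γ * k ^ e` at both ends of level `e`. The bound by `depth₀`
        -- ensures that the region is still long enough whenever `leaf` is applied.
        Reg : ℕ → ℕ × ℕ → Set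
        Reg s (e , x) = s ≤ depth₀ × s ℕ.* γ ℕ.* k ^ e ≤ x × x ℕ.+ s ℕ.* γ ℕ.* k ^ e ≤ N ℕ.* k ^ e

        Reg-suc : ∀ {s i} → Reg (suc s) i → Reg s i
        Reg-suc {s} {e , x} (a , b , c) = ℕₚ.<⇒≤ a , ℕₚ.≤-trans mono b , ℕₚ.≤-trans (ℕₚ.+-monoʳ-≤ x mono) c
          where
          mono : s ℕ.* γ ℕ.* k ^ e ≤ suc s ℕ.* γ ℕ.* k ^ e
          mono = ℕₚ.*-monoˡ-≤ (k ^ e) (ℕₚ.m≤n+m (s ℕ.* γ) γ)

        w : ℕ × ℕ → Carrier
        w (e , x) = V e x

        label : ℕ × ℕ → ℕ
        label (e , x) = toℕ (vl h hl hl-≈ e x)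

        -- Elimination by labels treats all levels together, so labels must be comparable across
        -- levels: each encodes four values of `α` and nothing about its position.
        label-≈ : ∀ i j → label i ≡ label j → w i ≈ w j
        label-≈ (e , x) (e′ , x′) eq =
          +-cong (cross (k ^ e ℕ.* M ℕ.+ x) _ (proj₁ two)) (-‿cong (cross x _ (proj₂ two)))
          where
          two = Finₚ.combine-injective (hl e (k ^ e ℕ.* M ℕ.+ x)) (hl e x) (hl e′ (k ^ e′ ℕ.* M ℕ.+ x′)) (hl e′ x′)
                  (Finₚ.toℕ-injective eq)
          cross : ∀ x y → hl e x ≡ hl e′ y → h e x ≈ h e′ y
          cross x y eq with Finₚ.combine-injective (α (k ^ e ℕ.* n ℕ.+ x)) (α (k ^ e ℕ.* n′ ℕ.+ x)) _ _ eq
          ... | eq₁ , eq₂ = +-cong (reflexive (≡.cong val eq₁)) (-‿cong (reflexive (≡.cong val eq₂)))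

        leaf : ∀ Z s q → (∀ q′ → toℕ q′ < toℕ q → ∀ {i} → Reg s i → (P q′ * w i) ∈ᴵ Z) →
          (∀ y → (P q * y) ∈ᴵ Z → y ∈ᴵ Z) → ∀ {i} → Reg (suc s) i → w i ∈ᴵ Z
        leaf Z s q kill cancel {e , x} (s< , x-low , x-high) = ≈ᶻ0⇒∈
          (ArrayLeaf.leaf k 2≤k S quotientRing Kh h hl (λ e x y eq → ≈⇒≈ᶻ (hl-≈ e x y eq))
            torsionFree P (λ E X a b → ≈⇒≈ᶻ (eqn-v E X a b)) N (λ e x a b → ≈⇒≈ᶻ (start e x a b))
            (s ℕ.* γ) U U+C≤N C+2KM≤U q
            (λ q′ lt e x a b → ∈⇒≈ᶻ0 (kill q′ lt {e , x} (ℕₚ.<⇒≤ s< , a , b)))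
            (λ y p → ∈⇒≈ᶻ0 (cancel y (≈ᶻ0⇒∈ p))) e x (low , high))
          where
          open Ideal Z
          open Quotient Z
          C = s ℕ.* γ ℕ.+ γ
          U = N ∸ C
          Cγ : C ≤ depth₀ ℕ.* γ
          Cγ = ℕₚ.≤-trans (ℕₚ.≤-reflexive (ℕₚ.+-comm (s ℕ.* γ) γ)) (ℕₚ.*-monoˡ-≤ γ s<)
          sum≤ : C ℕ.+ (C ℕ.+ 2 ℕ.* (Kh ℕ.* M)) ≤ N
          sum≤ = ≤-linear _ _ 1 (Cγ ⊕ Cγ) (alg C (depth₀ ℕ.* γ) (Kh ℕ.* M))
            where
            alg : ∀ C a b → C ℕ.+ (C ℕ.+ 2 ℕ.* b) ℕ.+ (a ℕ.+ a) ℕ.+ 1 ≡ 2 ℕ.* a ℕ.+ 2 ℕ.* b ℕ.+ 1 ℕ.+ (C ℕ.+ C)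
            alg = solve-∀
          C≤N : C ≤ N
          C≤N = ℕₚ.m+n≤o⇒m≤o C sum≤
          U+C≤N : U ℕ.+ C ≤ N
          U+C≤N = ℕₚ.≤-reflexive (ℕₚ.m∸n+n≡m C≤N)
          C+2KM≤U : C ℕ.+ 2 ℕ.* (Kh ℕ.* M) ≤ U
          C+2KM≤U = ℕₚ.m+n≤o⇒m≤o∸n _ (≡.subst (_≤ N) (ℕₚ.+-comm C _) sum≤)
          C≡ : C ≡ suc s ℕ.* γ
          C≡ = ℕₚ.+-comm (s ℕ.* γ) γ
          low : C ℕ.* k ^ e ≤ x ℕ.+ G
          low = ℕₚ.≤-trans (≡.subst (λ a → a ℕ.* k ^ e ≤ x) (≡.sym C≡) x-low) (ℕₚ.m≤m+n x G)
          high : x ≤ U ℕ.* k ^ e ℕ.+ G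
          high = ℕₚ.≤-trans (ℕₚ.+-cancelʳ-≤ (C ℕ.* k ^ e) _ _ (begin
            x ℕ.+ C ℕ.* k ^ e                 ≡⟨ ≡.cong (λ a → x ℕ.+ a ℕ.* k ^ e) C≡ ⟩
            x ℕ.+ suc s ℕ.* γ ℕ.* k ^ e       ≤⟨ x-high ⟩
            N ℕ.* k ^ e                       ≡⟨ ≡.cong (ℕ._* k ^ e) (ℕₚ.m∸n+n≡m C≤N) ⟨
            (U ℕ.+ C) ℕ.* k ^ e               ≡⟨ ℕₚ.*-distribʳ-+ (k ^ e) U C ⟩
            U ℕ.* k ^ e ℕ.+ C ℕ.* k ^ e       ∎)) (ℕₚ.m≤m+n _ G)
            where open ℕₚ.≤-Reasoning
          -- Positive integers are units, so they stay regular modulo `Z`.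
          torsionFree : ∀ n y → fold 0# (y +_) (suc n) ≈ᶻ 0# → y ≈ᶻ 0#
          torsionFree n y p with natInverse n
          ... | z , zi = ∈⇒≈ᶻ0 (∈-resp (trans (*-congˡ (sym (fold-* (suc n) y))) (trans (sym (*-assoc z _ y))
                            (trans (*-congʳ zi) (*-identityˡ y)))) (*-∈ z (≈ᶻ0⇒∈ p)))

        open Fitting w Reg (λ {s} {i} → Reg-suc {s} {i}) Kv label (λ i → Finₚ.toℕ<n _) label-≈
        open Vanishing P q₀ (unit-cancel u-inv) leaf

        -- The block of length `k ^ e` at `k ^ e * offset` survives all shrinkings; its positions
        -- are the kernel sequences of level `e` at argument `offset`.
        V≈0 : ∀ e r → r < k ^ e → V e (k ^ e ℕ.* offset ℕ.+ r) ≈ 0#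
        V≈0 e r r< = vanish {e , k ^ e ℕ.* offset ℕ.+ r}
          ( ℕₚ.≤-refl
          , ℕₚ.≤-trans (ℕₚ.≤-reflexive (ℕₚ.*-comm offset (k ^ e))) (ℕₚ.m≤m+n _ r)
          , ≤-linear _ _ (2 ℕ.* (Kh ℕ.* M) ℕ.* k ^ e ℕ.+ 1) r< (alg (k ^ e) offset r (Kh ℕ.* M)) )
          where
          alg : ∀ κ o r b → κ ℕ.* o ℕ.+ r ℕ.+ o ℕ.* κ ℕ.+ κ ℕ.+ (2 ℕ.* b ℕ.* κ ℕ.+ 1) ≡ (2 ℕ.* o ℕ.+ 2 ℕ.* b ℕ.+ 1) ℕ.* κ ℕ.+ suc r
          alg = solve-∀

      translation : ∀ n n′ → context α n ≡ context α n′ → ∀ e r → r < k ^ e →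
        let g = λ n → val (α (k ^ e ℕ.* n ℕ.+ r)) in
        g (n ℕ.+ offset ℕ.+ M) - g (n ℕ.+ offset) ≈ g (n′ ℕ.+ offset ℕ.+ M) - g (n′ ℕ.+ offset)
      translation n n′ same e r r< = rearrange
        (trans (sym (+-cong (+-cong (at n) (-‿cong (at n′))) (-‿cong (+-cong (at₀ n) (-‿cong (at₀ n′)))))) (V≈0 e r r<))
        where
        open Pair n n′ same
        open import Algebra.Properties.AbelianGroup +-abelianGroup using (x∙y⁻¹≈ε⇒x≈y; ⁻¹-∙-comm)
        open import Algebra.Properties.CommutativeSemigroup +-commutativeSemigroup using (interchange)
        alg : ∀ κ n o M r → κ ℕ.* n ℕ.+ (κ ℕ.* M ℕ.+ (κ ℕ.* o ℕ.+ r)) ≡ κ ℕ.* (n ℕ.+ o ℕ.+ M) ℕ.+ r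
        alg = solve-∀
        at : ∀ n → val (α (k ^ e ℕ.* n ℕ.+ (k ^ e ℕ.* M ℕ.+ (k ^ e ℕ.* offset ℕ.+ r)))) ≈ val (α (k ^ e ℕ.* (n ℕ.+ offset ℕ.+ M) ℕ.+ r))
        at n = reflexive (≡.cong (val ∘ α) (alg (k ^ e) n offset M r))
        alg₀ : ∀ κ n o r → κ ℕ.* n ℕ.+ (κ ℕ.* o ℕ.+ r) ≡ κ ℕ.* (n ℕ.+ o) ℕ.+ r
        alg₀ = solve-∀
        at₀ : ∀ n → val (α (k ^ e ℕ.* n ℕ.+ (k ^ e ℕ.* offset ℕ.+ r))) ≈ val (α (k ^ e ℕ.* (n ℕ.+ offset) ℕ.+ r))
        at₀ n = reflexive (≡.cong (val ∘ α) (alg₀ (k ^ e) n offset r))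
        rearrange : ∀ {a b c d} → (a - b) - (c - d) ≈ 0# → a - c ≈ b - d
        rearrange {a} {b} {c} {d} p = x∙y⁻¹≈ε⇒x≈y _ _ (trans swap p)
          where
          swap : (a - c) - (b - d) ≈ (a - b) - (c - d)
          swap = trans (+-congˡ (sym (⁻¹-∙-comm b (- d)))) (trans (interchange a (- c) (- b) (- - d)) (+-congˡ (⁻¹-∙-comm c (- d))))

-- The automaton

divMod : ∀ n k .{{_ : NonZero k}} → n ≡ k ℕ.* (n / k) ℕ.+ n % k
divMod n k = ≡.trans (m≡m%n+[m/n]*n n k) (≡.trans (ℕₚ.+-comm (n % k) _) (≡.cong (ℕ._+ n % k) (ℕₚ.*-comm (n / k) k)))

%-unique : ∀ k .{{_ : NonZero k}} n {s} → s < k → (k ℕ.* n ℕ.+ s) % k ≡ s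
%-unique k n {s} s<k = ≡.trans (≡.cong (_% k) (≡.trans (ℕₚ.+-comm _ s) (≡.cong (s ℕ.+_) (ℕₚ.*-comm k n))))
  (≡.trans ([m+kn]%n≡m%n s n k) (m<n⇒m%n≡m s<k))

/-unique : ∀ k .{{_ : NonZero k}} n {s} → s < k → (k ℕ.* n ℕ.+ s) / k ≡ n
/-unique k n {s} s<k = ≡.sym (ℕₚ.*-cancelˡ-≡ n _ k (ℕₚ.+-cancelʳ-≡ s _ _
  (≡.trans (divMod (k ℕ.* n ℕ.+ s) k) (≡.cong (k ℕ.* ((k ℕ.* n ℕ.+ s) / k) ℕ.+_) (%-unique k n s<k)))))

module _ (k : ℕ) (2≤k : 2 ≤ k) (S : Shape) where
  open Terms k 2≤k
  open Shape S

  -- Separate from `Machine` because `Y` is chosen from these numbers, which must not depend on it.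
  -- `T` bounds a remainder modulo `k ^ d` shifted by `D`.
  module Sizes (m contexts offset M : ℕ) where
    initial profiles T codes : ℕ
    initial  = offset ℕ.+ M
    profiles = m ^ initial ℕ.* (m ^ contexts ℕ.* m ^ contexts)
    T        = D ℕ.+ k ^ d
    codes    = ((m ^ T) ^ (k ^ profiles)) ^ suc profiles

  module Machine {c ℓ} (R : CommutativeRing c ℓ) where
    open CommutativeRing R
    open Sums R

    module _
      (P : Fin Q → Carrier) (q₀ : Fin Q) (u : Carrier) (u-inv : P q₀ * u ≈ 1#)
      (m : ℕ) (val : Fin m → Carrier) (α : ℕ → Fin m)
      (eqn : ∀ N → sum (λ q → P q * term 0# (val ∘ α) (I q) N (J q)) ≈ 0#)
      (contexts offset M : ℕ) (0<M : 0 < M) (context : ℕ → Fin contexts)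
      (translation : ∀ n n′ → context n ≡ context n′ → ∀ e r → r < k ^ e →
        val (α (k ^ e ℕ.* (n ℕ.+ offset ℕ.+ M) ℕ.+ r)) - val (α (k ^ e ℕ.* (n ℕ.+ offset) ℕ.+ r)) ≈
        val (α (k ^ e ℕ.* (n′ ℕ.+ offset ℕ.+ M) ℕ.+ r)) - val (α (k ^ e ℕ.* (n′ ℕ.+ offset) ℕ.+ r)))
      (Y : ℕ) (Y≥ : k ^ d ℕ.* k ^ Sizes.codes m contexts offset M ℕ.+ Sizes.T m contexts offset M ≤ Y)
      where

      open Sizes m contexts offset M

      kernel : ℕ → ℕ → ℕ → Fin m
      kernel e r n = α (k ^ e ℕ.* n ℕ.+ r)

      0<initial : 0 < initial
      0<initial = ℕₚ.≤-trans 0<M (ℕₚ.m≤n+m M offset)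

      -- Bounding the search by `Y` makes it decidable. The default 0 stands for contexts not
      -- occurring up to `Y`, which `agree` never consults.
      rep : Fin contexts → ℕ
      rep κ with Finₚ.any? {suc Y} (λ i → context (toℕ i) Finₚ.≟ κ)
      ... | yes (i , _) = toℕ i
      ... | no _        = 0

      rep-context : ∀ n → n ≤ Y → context (rep (context n)) ≡ context n
      rep-context n n≤Y with Finₚ.any? {suc Y} (λ i → context (toℕ i) Finₚ.≟ context n)
      ... | yes (_ , e) = e
      ... | no ¬e = ⊥-elim (¬e (fromℕ< (s≤s n≤Y) , ≡.cong (context) (Finₚ.toℕ-fromℕ< (s≤s n≤Y))))

      profile₀ : ℕ → ℕ → Fin initial → Fin m
      profile₀ e r x = kernel e r (toℕ x)

      profile₁ profile₂ : ℕ → ℕ → Fin contexts → Fin m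
      profile₁ e r κ = kernel e r (rep κ ℕ.+ offset)
      profile₂ e r κ = kernel e r (rep κ ℕ.+ offset ℕ.+ M)

      -- The profile determines the kernel sequence on [0 , Y], while the number of profiles does not
      -- depend on Y.
      profile : ℕ → ℕ → Fin profiles
      profile e r = combine (funToFin (profile₀ e r)) (combine (funToFin (profile₁ e r)) (funToFin (profile₂ e r)))

      module _ e r e′ r′ (same : profile e r ≡ profile e′ r′) where
        private
          split₀ = Finₚ.combine-injective (funToFin (profile₀ e r)) _ (funToFin (profile₀ e′ r′)) _ same
          split₁ = Finₚ.combine-injective (funToFin (profile₁ e r)) (funToFin (profile₂ e r))
                     (funToFin (profile₁ e′ r′)) (funToFin (profile₂ e′ r′)) (proj₂ split₀)

        agree-initial : ∀ n → n < initial → kernel e r n ≡ kernel e′ r′ n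
        agree-initial n n< = ≡.subst (λ z → kernel e r z ≡ kernel e′ r′ z) (Finₚ.toℕ-fromℕ< n<)
          (funToFin-injective (profile₀ e r) (profile₀ e′ r′) (proj₁ split₀) (fromℕ< n<))

        -- For `n` = `n₁ + offset + M`, the increment from `n₁ + offset` to `n` equals the one at
        -- the representative of the context of `n₁`, and the profile records the latter.
        agree : r < k ^ e → r′ < k ^ e′ → ∀ n → n ≤ Y → val (kernel e r n) ≈ val (kernel e′ r′ n)
        agree r< r′< = <-rec _ step
          where
          step : ∀ n → (∀ {n′} → n′ < n → n′ ≤ Y → val (kernel e r n′) ≈ val (kernel e′ r′ n′)) →
                 n ≤ Y → val (kernel e r n) ≈ val (kernel e′ r′ n)
          step n IH n≤Y with n ℕ.<? initial
          ... | yes n< = reflexive (≡.cong val (agree-initial n n<))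
          ... | no n≮ = ≡.subst (λ z → val (kernel e r z) ≈ val (kernel e′ r′ z)) n≡ (begin
              val (kernel e r (n₁ ℕ.+ offset ℕ.+ M))                                   ≈⟨ unfold e r r< ⟩
              (val (kernel e r (ρ ℕ.+ offset ℕ.+ M)) - val (kernel e r (ρ ℕ.+ offset)))
                + val (kernel e r (n₁ ℕ.+ offset))                                     ≈⟨ +-cong (+-cong same₂ (-‿cong same₁)) (IH n₁+o<n (ℕₚ.≤-trans (ℕₚ.<⇒≤ n₁+o<n) n≤Y)) ⟩
              (val (kernel e′ r′ (ρ ℕ.+ offset ℕ.+ M)) - val (kernel e′ r′ (ρ ℕ.+ offset)))
                + val (kernel e′ r′ (n₁ ℕ.+ offset))                                   ≈⟨ unfold e′ r′ r′< ⟨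
              val (kernel e′ r′ (n₁ ℕ.+ offset ℕ.+ M))                                 ∎)
            where
            open import Relation.Binary.Reasoning.Setoid setoid
            n₁ = n ∸ initial
            n≡ : n₁ ℕ.+ offset ℕ.+ M ≡ n
            n≡ = ≡.trans (ℕₚ.+-assoc n₁ offset M) (ℕₚ.m∸n+n≡m (ℕₚ.≮⇒≥ n≮))
            n₁≤Y : n₁ ≤ Y
            n₁≤Y = ℕₚ.≤-trans (ℕₚ.m∸n≤m n initial) n≤Y
            n₁+o<n : n₁ ℕ.+ offset < n
            n₁+o<n = ≡.subst (n₁ ℕ.+ offset <_) n≡ (ℕₚ.m<m+n _ 0<M)
            κ = context n₁
            ρ = rep κ
            same₁ : val (kernel e r (ρ ℕ.+ offset)) ≈ val (kernel e′ r′ (ρ ℕ.+ offset))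
            same₁ = reflexive (≡.cong val (funToFin-injective (profile₁ e r) (profile₁ e′ r′) (proj₁ split₁) κ))
            same₂ : val (kernel e r (ρ ℕ.+ offset ℕ.+ M)) ≈ val (kernel e′ r′ (ρ ℕ.+ offset ℕ.+ M))
            same₂ = reflexive (≡.cong val (funToFin-injective (profile₂ e r) (profile₂ e′ r′) (proj₂ split₁) κ))
            sub-add : ∀ x y → x ≈ (x - y) + y
            sub-add x y = sym (trans (+-assoc x (- y) y) (trans (+-congˡ (-‿inverseˡ y)) (+-identityʳ x)))
            unfold : ∀ e r → r < k ^ e → val (kernel e r (n₁ ℕ.+ offset ℕ.+ M)) ≈
              (val (kernel e r (ρ ℕ.+ offset ℕ.+ M)) - val (kernel e r (ρ ℕ.+ offset))) + val (kernel e r (n₁ ℕ.+ offset))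
            unfold e r r< = trans (sub-add _ _) (+-congʳ (translation n₁ ρ (≡.sym (rep-context n₁ n₁≤Y)) e r r<))

      Old : ℕ → Fin profiles → Set
      Old E ρ = ∃ λ (e : Fin (suc E)) → ∃ λ (r : Fin (k ^ toℕ e)) → profile (toℕ e) (toℕ r) ≡ ρ

      old? : ∀ E ρ → Dec (Old E ρ)
      old? E ρ = Finₚ.any? (λ e → Finₚ.any? (λ r → profile (toℕ e) (toℕ r) Finₚ.≟ ρ))

      Stable : ℕ → Set
      Stable E = ∀ (r : Fin (k ^ suc E)) → Old E (profile (suc E) (toℕ r))

      -- Otherwise each of the levels 1 to `profiles + 1` would show a profile absent from all
      -- earlier levels, giving too many distinct profiles.
      stable : ∃ λ E → E ≤ profiles × Stable E
      stable with Finₚ.any? {suc profiles} (λ E → Finₚ.all? (λ r → old? (toℕ E) (profile (suc (toℕ E)) (toℕ r))))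
      ... | yes (E , st) = toℕ E , ℕₚ.≤-pred (Finₚ.toℕ<n E) , st
      ... | no ¬st = ⊥-elim (contra (Finₚ.pigeonhole (ℕₚ.n<1+n profiles) (λ E → profile (suc (toℕ E)) (toℕ (new E .proj₁)))))
        where
        new : (E : Fin (suc profiles)) → ∃ λ (r : Fin (k ^ suc (toℕ E))) → ¬ Old (toℕ E) (profile (suc (toℕ E)) (toℕ r))
        new E = Finₚ.¬∀⟶∃¬ _ _ (λ r → old? (toℕ E) (profile (suc (toℕ E)) (toℕ r))) (λ st → ¬st (E , st))
        contra : ¬ (∃ λ E₁ → ∃ λ E₂ → toℕ E₁ < toℕ E₂ ×
                   profile (suc (toℕ E₁)) (toℕ (new E₁ .proj₁)) ≡ profile (suc (toℕ E₂)) (toℕ (new E₂ .proj₁)))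
        contra (E₁ , E₂ , lt , eq) = new E₂ .proj₂ (fromℕ< (s≤s lt) , fromℕ< r<′ ,
            ≡.trans (≡.cong₂ profile e≡ (Finₚ.toℕ-fromℕ< r<′)) eq)
          where
          r₁ = toℕ (new E₁ .proj₁)
          e≡ : toℕ (fromℕ< (s≤s lt)) ≡ suc (toℕ E₁)
          e≡ = Finₚ.toℕ-fromℕ< (s≤s lt)
          r<′ : r₁ < k ^ toℕ (fromℕ< (s≤s lt))
          r<′ = ≡.subst (λ z → r₁ < k ^ z) (≡.sym e≡) (Finₚ.toℕ<n (new E₁ .proj₁))

      -- States, transitions and outputs

      module Automaton (E : ℕ) (E≤ : E ≤ profiles) (st : Stable E) where

        Valid : ℕ × ℕ → Set
        Valid (e , r) = e ≤ E × r < k ^ e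

        jump : ∀ ρ → Dec (ρ < k ^ suc E) → ℕ × ℕ
        jump ρ (yes p) = let e , r , _ = st (fromℕ< p) in toℕ e , toℕ r
        -- A default: valid states and digits below `k` never lead here.
        jump ρ (no _)  = 0 , 0

        next′ : ∀ e → ℕ → ℕ → Dec (e < E) → ℕ × ℕ
        next′ e r s (yes _) = suc e , k ^ e ℕ.* s ℕ.+ r
        next′ e r s (no _)  = jump (k ^ E ℕ.* s ℕ.+ r) (_ ℕ.<? _)

        -- Digits are read from the least significant one. Above level `E`, stability provides an
        -- earlier state with the same profile.
        next : ℕ × ℕ → ℕ → ℕ × ℕ
        next (e , r) s = next′ e r s (e ℕ.<? E)

        digit< : ∀ e {r s} → r < k ^ e → s < k → k ^ e ℕ.* s ℕ.+ r < k ^ suc e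
        digit< e {r} {s} r< s< = begin-strict
          k ^ e ℕ.* s ℕ.+ r        <⟨ ℕₚ.+-monoʳ-< _ r< ⟩
          k ^ e ℕ.* s ℕ.+ k ^ e    ≡⟨ alg (k ^ e) s ⟩
          suc s ℕ.* k ^ e          ≤⟨ ℕₚ.*-monoˡ-≤ (k ^ e) s< ⟩
          k ^ suc e                ∎
          where
          open ℕₚ.≤-Reasoning
          alg : ∀ a s → a ℕ.* s ℕ.+ a ≡ suc s ℕ.* a
          alg = solve-∀

        digit-pos : ∀ e n s r → k ^ suc e ℕ.* n ℕ.+ (k ^ e ℕ.* s ℕ.+ r) ≡ k ^ e ℕ.* (k ℕ.* n ℕ.+ s) ℕ.+ r
        digit-pos e n s r = alg k (k ^ e) n s r
          where
          alg : ∀ k a n s r → k ℕ.* a ℕ.* n ℕ.+ (a ℕ.* s ℕ.+ r) ≡ a ℕ.* (k ℕ.* n ℕ.+ s) ℕ.+ r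
          alg = solve-∀

        module _ {e r s} (valid : Valid (e , r)) (s<k : s < k) where

          jump-spec : ∀ ρ → ρ < k ^ suc E → (p : Dec (ρ < k ^ suc E)) → let e′ , r′ = jump ρ p in
            Valid (e′ , r′) × profile e′ r′ ≡ profile (suc E) ρ
          jump-spec ρ ρ< (no ¬p) = ⊥-elim (¬p ρ<)
          jump-spec ρ ρ< (yes p) with st (fromℕ< p)
          ... | e′ , r′ , eq = (ℕₚ.≤-pred (Finₚ.toℕ<n e′) , Finₚ.toℕ<n r′)
                             , ≡.trans eq (≡.cong (profile (suc E)) (Finₚ.toℕ-fromℕ< p))

          -- Values are compared only up to `Y`, but labels at 0 agree exactly; this keeps leading
          -- zeros from changing the output.
          next-spec : let e′ , r′ = next (e , r) s in
            Valid (e′ , r′)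
            × (∀ n → n ≤ Y → val (kernel e′ r′ n) ≈ val (kernel e r (k ℕ.* n ℕ.+ s)))
            × kernel e′ r′ 0 ≡ kernel e r (k ℕ.* 0 ℕ.+ s)
          next-spec with e ℕ.<? E
          ... | yes e<E = (e<E , digit< e (proj₂ valid) s<k)
                        , (λ n _ → reflexive (≡.cong (val ∘ α) (digit-pos e n s r)))
                        , ≡.cong α (digit-pos e 0 s r)
          ... | no e≮E with ℕₚ.≤-antisym (proj₁ valid) (ℕₚ.≮⇒≥ e≮E)
          ...   | ≡.refl with jump (k ^ E ℕ.* s ℕ.+ r) (_ ℕ.<? _) | jump-spec (k ^ E ℕ.* s ℕ.+ r) (digit< E (proj₂ valid) s<k) (_ ℕ.<? _)
          ...     | e′ , r′ | v′ , eq = v′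
                        , (λ n n≤Y → trans (agree e′ r′ (suc E) ρ eq (proj₂ v′) (digit< E (proj₂ valid) s<k) n n≤Y)
                                           (reflexive (≡.cong (val ∘ α) (digit-pos e n s r))))
                        , ≡.trans (agree-initial e′ r′ (suc E) ρ eq 0 0<initial) (≡.cong α (digit-pos e 0 s r))
                where ρ = k ^ E ℕ.* s ℕ.+ r

        -- The first argument is fuel, since `suc n / k` is not structurally smaller; any fuel of at
        -- least `n` gives the same result.
        run : ℕ → ℕ × ℕ → ℕ → Fin m
        run zero    q n       = α (proj₂ q)
        run (suc f) q zero    = α (proj₂ q)
        run (suc f) q (suc n) = run f (next q (suc n % k)) (suc n / k)

        /k≤ : ∀ n → suc n / k ≤ n
        /k≤ n = ℕₚ.≤-pred (m/n<m (suc n) k 2≤k)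

        run-fuel : ∀ f f′ q n → n ≤ f → n ≤ f′ → run f q n ≡ run f′ q n
        run-fuel zero    zero     q zero    _ _ = ≡.refl
        run-fuel zero    (suc f′) q zero    _ _ = ≡.refl
        run-fuel (suc f) zero     q zero    _ _ = ≡.refl
        run-fuel (suc f) (suc f′) q zero    _ _ = ≡.refl
        run-fuel (suc f) (suc f′) q (suc n) (s≤s a) (s≤s b) =
          run-fuel f f′ _ _ (ℕₚ.≤-trans (/k≤ n) a) (ℕₚ.≤-trans (/k≤ n) b)

        output : ℕ × ℕ → ℕ → Fin m
        output q n = run n q n

        output-step : ∀ q n s → Valid q → s < k → output q (k ℕ.* n ℕ.+ s) ≡ output (next q s) n
        output-step q n s valid s<k with k ℕ.* n ℕ.+ s in eq
        ... | suc N = ≡.trans (run-fuel N (suc N / k) _ _ (/k≤ N) ℕₚ.≤-refl) (≡.cong₂ (λ a b → output (next q a) b)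
                (≡.trans (≡.cong (_% k) (≡.sym eq)) (%-unique k n s<k))
                (≡.trans (≡.cong (_/ k) (≡.sym eq)) (/-unique k n s<k)))
        -- Here `run` stops without reading the digit 0, and the agreement of labels at 0
        -- compensates.
        ... | zero with ℕₚ.m+n≡0⇒n≡0 (k ℕ.* n) eq | ℕₚ.m*n≡0⇒m≡0∨n≡0 k (ℕₚ.m+n≡0⇒m≡0 (k ℕ.* n) eq)
        ...   | ≡.refl | inj₁ k≡0 = ⊥-elim (ℕ.≢-nonZero⁻¹ k k≡0)
        ...   | ≡.refl | inj₂ ≡.refl = begin
              α (proj₂ q)                                   ≡⟨ ≡.cong α (zero-pos (k ^ proj₁ q) (proj₂ q) k) ⟩
              kernel (proj₁ q) (proj₂ q) (k ℕ.* 0 ℕ.+ 0)    ≡⟨ proj₂ (proj₂ (next-spec valid s<k)) ⟨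
              kernel (proj₁ q′) (proj₂ q′) 0                ≡⟨ ≡.cong α (zero-pos′ (k ^ proj₁ q′) (proj₂ q′)) ⟩
              α (proj₂ q′)                                  ∎
          where
          open ≡.≡-Reasoning
          q′ = next q 0
          zero-pos : ∀ a r k → r ≡ a ℕ.* (k ℕ.* 0 ℕ.+ 0) ℕ.+ r
          zero-pos = solve-∀
          zero-pos′ : ∀ a r → a ℕ.* 0 ℕ.+ r ≡ r
          zero-pos′ = solve-∀

        output-agree : ∀ n q → Valid q → n ≤ Y → val (output q n) ≈ val (kernel (proj₁ q) (proj₂ q) n)
        output-agree = <-rec _ step
          where
          step : ∀ n → (∀ {n′} → n′ < n → ∀ q → Valid q → n′ ≤ Y → val (output q n′) ≈ val (kernel (proj₁ q) (proj₂ q) n′)) →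
                 ∀ q → Valid q → n ≤ Y → val (output q n) ≈ val (kernel (proj₁ q) (proj₂ q) n)
          step zero    IH q valid _ = reflexive (≡.cong (val ∘ α) (≡.sym (≡.cong (ℕ._+ proj₂ q) (ℕₚ.*-zeroʳ (k ^ proj₁ q)))))
          step n@(suc n′) IH q valid n≤Y = begin
            val (output q n)                                            ≈⟨ reflexive (≡.cong (val ∘ output q) (divMod n k)) ⟩
            val (output q (k ℕ.* (n / k) ℕ.+ n % k))                    ≈⟨ reflexive (≡.cong val (output-step q (n / k) (n % k) valid (m%n<n n k))) ⟩
            val (output (next q (n % k)) (n / k))                       ≈⟨ IH (s≤s (/k≤ n′)) _ (proj₁ spec) n/k≤Y ⟩
            val (kernel (proj₁ q′) (proj₂ q′) (n / k))                  ≈⟨ proj₁ (proj₂ spec) (n / k) n/k≤Y ⟩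
            val (kernel (proj₁ q) (proj₂ q) (k ℕ.* (n / k) ℕ.+ n % k))  ≈⟨ reflexive (≡.cong (val ∘ kernel (proj₁ q) (proj₂ q)) (divMod n k)) ⟨
            val (kernel (proj₁ q) (proj₂ q) n)                          ∎
            where
            open import Relation.Binary.Reasoning.Setoid setoid
            q′ = next q (n % k)
            spec = next-spec valid (m%n<n n k)
            n/k≤Y : n / k ≤ Y
            n/k≤Y = ℕₚ.≤-trans (m/n≤m n k) n≤Y

        lastDigit : ∀ e n r → k ^ suc e ℕ.* n ℕ.+ r ≡ k ℕ.* (k ^ e ℕ.* n ℕ.+ r / k) ℕ.+ r % k
        lastDigit e n r = ≡.trans (≡.cong (k ^ suc e ℕ.* n ℕ.+_) (divMod r k)) (alg k (k ^ e) n (r / k) (r % k))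
          where
          alg : ∀ k a n x y → k ℕ.* a ℕ.* n ℕ.+ (k ℕ.* x ℕ.+ y) ≡ k ℕ.* (a ℕ.* n ℕ.+ x) ℕ.+ y
          alg = solve-∀

        r/k< : ∀ e r → r < k ^ suc e → r / k < k ^ e
        r/k< e r r< = m<n*o⇒m/o<n (≡.subst (r <_) (ℕₚ.*-comm k (k ^ e)) r<)

        output-kernel : ∀ e r q → Valid q → r < k ^ e →
          ∃ λ q′ → Valid q′ × ∀ n → output q (k ^ e ℕ.* n ℕ.+ r) ≡ output q′ n
        output-kernel zero zero q valid _ = q , valid , λ n → ≡.cong (output q) (≡.trans (ℕₚ.+-identityʳ (1 ℕ.* n)) (ℕₚ.*-identityˡ n))
        output-kernel zero (suc r) q valid (s≤s ())
        output-kernel (suc e) r q valid r<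
          with output-kernel e (r / k) (next q (r % k)) (proj₁ (next-spec valid (m%n<n r k))) (r/k< e r r<)
        ... | q′ , valid′ , h = q′ , valid′ , λ n → ≡.trans (≡.cong (output q) (lastDigit e n r))
                (≡.trans (output-step q _ (r % k) valid (m%n<n r k)) (h n))

        -- Reduction to small arguments

        infix 4 _≃_
        _≃_ : ℕ → ℕ → Set
        n ≃ n′ = ∀ q → Valid q → ∀ t → t < T → output q (n ℕ.+ t) ≡ output q (n′ ℕ.+ t)

        -- The carry of `s + t` is again below `T`, so the length `T` is preserved when a digit is
        -- appended.
        ≃-step : ∀ s n n′ → s < k → n ≃ n′ → k ℕ.* n ℕ.+ s ≃ k ℕ.* n′ ℕ.+ s
        ≃-step s n n′ s<k h q valid t t<T =
          ≡.trans (move n) (≡.trans (h _ (proj₁ (next-spec valid (m%n<n (s ℕ.+ t) k))) _ carry<) (≡.sym (move n′)))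
          where
          carry< : (s ℕ.+ t) / k < T
          carry< = m<n*o⇒m/o<n (begin-strict
            s ℕ.+ t          <⟨ ℕₚ.+-monoˡ-< t s<k ⟩
            k ℕ.+ t          ≤⟨ ℕₚ.+-monoʳ-≤ k (ℕₚ.m≤m*n t k) ⟩
            suc t ℕ.* k      ≤⟨ ℕₚ.*-monoˡ-≤ k t<T ⟩
            T ℕ.* k          ∎)
            where open ℕₚ.≤-Reasoning
          alg : ∀ k n x y → k ℕ.* n ℕ.+ (k ℕ.* x ℕ.+ y) ≡ k ℕ.* (n ℕ.+ x) ℕ.+ y
          alg = solve-∀
          move : ∀ n → output q (k ℕ.* n ℕ.+ s ℕ.+ t) ≡ output (next q ((s ℕ.+ t) % k)) (n ℕ.+ (s ℕ.+ t) / k)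
          move n = ≡.trans (≡.cong (output q) (≡.trans (ℕₚ.+-assoc (k ℕ.* n) s t)
              (≡.trans (≡.cong (k ℕ.* n ℕ.+_) (divMod (s ℕ.+ t) k)) (alg k n _ _))))
            (output-step q _ _ valid (m%n<n (s ℕ.+ t) k))

        ≃-steps : ∀ i r n n′ → r < k ^ i → n ≃ n′ → k ^ i ℕ.* n ℕ.+ r ≃ k ^ i ℕ.* n′ ℕ.+ r
        ≃-steps zero zero n n′ _ h = ≡.subst₂ _≃_ (unit n) (unit n′) h
          where
          unit : ∀ n → n ≡ 1 ℕ.* n ℕ.+ 0
          unit = solve-∀
        ≃-steps zero (suc r) n n′ (s≤s ())
        ≃-steps (suc i) r n n′ r< h = ≡.subst₂ _≃_ (≡.sym (lastDigit i n r)) (≡.sym (lastDigit i n′ r))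
          (≃-step (r % k) _ _ (m%n<n r k) (≃-steps i (r / k) n n′ (r/k< i r r<) h))

        window : ℕ → ℕ → ℕ → Fin T → Fin m
        window n e r t = output (e , r) (n ℕ.+ toℕ t)

        windows : ℕ → ℕ → Fin (k ^ profiles) → Fin (m ^ T)
        windows n e r = funToFin (window n e (toℕ r))

        rows : ℕ → Fin (suc profiles) → Fin ((m ^ T) ^ (k ^ profiles))
        rows n e = funToFin (windows n (toℕ e))

        -- All levels up to `profiles` and residues below `k ^ profiles` are included, not only the
        -- states, so that `codes` does not depend on `E`.
        code : ℕ → Fin codes
        code n = funToFin (rows n)

        code-≃ : ∀ n n′ → code n ≡ code n′ → n ≃ n′
        code-≃ n n′ eq (e , r) (e≤E , r<) t t<T =
          ≡.subst₂ (λ q t → output q (n ℕ.+ t) ≡ output q (n′ ℕ.+ t))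
            (≡.cong₂ _,_ (Finₚ.toℕ-fromℕ< e<) (Finₚ.toℕ-fromℕ< r<′)) (Finₚ.toℕ-fromℕ< t<T)
            (funToFin-injective (window n (toℕ (fromℕ< e<)) (toℕ (fromℕ< r<′))) (window n′ (toℕ (fromℕ< e<)) (toℕ (fromℕ< r<′)))
              (funToFin-injective (windows n (toℕ (fromℕ< e<))) (windows n′ (toℕ (fromℕ< e<)))
                (funToFin-injective (rows n) (rows n′) eq (fromℕ< e<))
                (fromℕ< r<′))
              (fromℕ< t<T))
          where
          e< : e < suc profiles
          e< = s≤s (ℕₚ.≤-trans e≤E E≤)
          r<′ : r < k ^ profiles
          r<′ = ℕₚ.<-≤-trans r< (ℕₚ.^-monoʳ-≤ k (ℕₚ.≤-trans e≤E E≤))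

        quotient-< : ∀ {n i j} (let instance _ = k^≢0 i) (let instance _ = k^≢0 j) →
          i < j → k ^ i ≤ n → n / k ^ j < n / k ^ i
        quotient-< {n} {i} {j} i<j k^i≤n = ℕₚ.≰⇒> λ a≤b → ℕₚ.<-irrefl ≡.refl (begin-strict
          n                            ≡⟨ divMod n (k ^ i) ⟩
          k ^ i ℕ.* a ℕ.+ n % k ^ i    <⟨ ℕₚ.+-monoʳ-< _ (m%n<n n (k ^ i)) ⟩
          k ^ i ℕ.* a ℕ.+ k ^ i        ≤⟨ ℕₚ.+-monoʳ-≤ _ (ℕₚ.m≤m*n (k ^ i) a {{ℕ.≢-nonZero a≢0}}) ⟩
          k ^ i ℕ.* a ℕ.+ k ^ i ℕ.* a  ≡⟨ alg (k ^ i) a ⟩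
          2 ℕ.* k ^ i ℕ.* a            ≤⟨ ℕₚ.*-mono-≤ (ℕₚ.≤-trans (ℕₚ.*-monoˡ-≤ (k ^ i) 2≤k) (ℕₚ.^-monoʳ-≤ k i<j)) a≤b ⟩
          k ^ j ℕ.* b                  ≤⟨ ℕₚ.m≤m+n _ _ ⟩
          k ^ j ℕ.* b ℕ.+ n % k ^ j    ≡⟨ divMod n (k ^ j) ⟨
          n                            ∎)
          where
          open ℕₚ.≤-Reasoning
          instance
            _ = k^≢0 i
            _ = k^≢0 j
          a = n / k ^ i
          b = n / k ^ j
          alg : ∀ x a → x ℕ.* a ℕ.+ x ℕ.* a ≡ 2 ℕ.* x ℕ.* a
          alg = solve-∀
          a≢0 : a ≢ 0
          a≢0 a≡0 = ℕₚ.<⇒≱ (m%n<n n (k ^ i)) (≡.subst (k ^ i ≤_)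
            (≡.trans (divMod n (k ^ i)) (≡.cong (ℕ._+ n % k ^ i) (≡.trans (≡.cong (k ^ i ℕ.*_) a≡0) (ℕₚ.*-zeroʳ (k ^ i))))) k^i≤n)

        -- Cutting out the digits between two prefixes with the same code.
        shrink : ∀ n → ∃ λ n′ → n′ < k ^ codes × n ≃ n′
        shrink = <-rec _ step
          where
          step : ∀ n → (∀ {n₁} → n₁ < n → ∃ λ n′ → n′ < k ^ codes × n₁ ≃ n′) → ∃ λ n′ → n′ < k ^ codes × n ≃ n′
          step n IH with n ℕ.<? k ^ codes
          ... | yes n< = n , n< , λ _ _ _ _ → ≡.refl
          ... | no n≮ = cut (Finₚ.pigeonhole (ℕₚ.n<1+n codes) (λ i → code ((n / k ^ toℕ i) {{k^≢0 (toℕ i)}})))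
            where
            cut : (∃ λ i → ∃ λ j → toℕ i < toℕ j ×
                    code ((n / k ^ toℕ i) {{k^≢0 (toℕ i)}}) ≡ code ((n / k ^ toℕ j) {{k^≢0 (toℕ j)}})) →
                  ∃ λ n′ → n′ < k ^ codes × n ≃ n′
            cut (i , j , i<j , same) = let n′ , n′< , h = IH n₁<n in
              n′ , n′< , λ q valid t t< → ≡.trans (n≃n₁ q valid t t<) (h q valid t t<)
              where
              instance
                _ = k^≢0 (toℕ i)
                _ = k^≢0 (toℕ j)
              n₁ = k ^ toℕ i ℕ.* (n / k ^ toℕ j) ℕ.+ n % k ^ toℕ i
              n≃n₁ : n ≃ n₁
              n≃n₁ = ≡.subst (_≃ n₁) (≡.sym (divMod n (k ^ toℕ i)))
                (≃-steps (toℕ i) _ (n / k ^ toℕ i) (n / k ^ toℕ j) (m%n<n n (k ^ toℕ i)) (code-≃ (n / k ^ toℕ i) (n / k ^ toℕ j) same))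
              n₁<n : n₁ < n
              n₁<n = ≡.subst (n₁ <_) (≡.sym (divMod n (k ^ toℕ i)))
                (ℕₚ.+-monoˡ-< _ (ℕₚ.*-monoʳ-< (k ^ toℕ i) (quotient-< i<j
                  (ℕₚ.≤-trans (ℕₚ.^-monoʳ-≤ k (ℕₚ.≤-pred (Finₚ.toℕ<n i))) (ℕₚ.≮⇒≥ n≮)))))

        -- The output sequence solves the equation

        q∅ : ℕ × ℕ
        q∅ = 0 , 0

        valid∅ : Valid q∅
        valid∅ = z≤n , s≤s z≤n

        ã : ℕ → Fin m
        ã = output q∅

        ã-agree : ∀ n → n ≤ Y → val (ã n) ≈ val (α n)
        ã-agree n n≤Y = trans (output-agree n q∅ valid∅ n≤Y) (reflexive (≡.cong (val ∘ α) (unit n)))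
          where
          unit : ∀ n → 1 ℕ.* n ℕ.+ 0 ≡ n
          unit = solve-∀

        D≤Y : D ≤ Y
        D≤Y = ℕₚ.≤-trans (ℕₚ.≤-trans (ℕₚ.m≤m+n D _) (ℕₚ.m≤n+m T (k ^ d ℕ.* k ^ codes))) Y≥

        Equation : ℕ → Set ℓ
        Equation N = sum (λ q → P q * term 0# (val ∘ ã) (I q) N (J q)) ≈ 0#

        small : ∀ N → N ≤ Y → Equation N
        small N N≤Y = trans (sum-cong-≋ (λ q → *-congˡ (term-rel _≈_ (I q) N (J q) (λ y e → ã-agree y (y≤Y q y e)) refl))) (eqn N)
          where
          y≤Y : ∀ q y → N ≡ k ^ I q ℕ.* y ℕ.+ J q → y ≤ Y
          y≤Y q y e = ℕₚ.≤-trans (ℕₚ.≤-trans (ℕₚ.m≤n*m y (k ^ I q) {{k^≢0 (I q)}}) (ℕₚ.m≤m+n _ (J q)))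
                        (≡.subst (_≤ Y) e N≤Y)

        ã-local : ∀ n n′ → n ≃ n′ → ∀ f y → y < T → ã (k ^ f ℕ.* n ℕ.+ y) ≡ ã (k ^ f ℕ.* n′ ℕ.+ y)
        ã-local n n′ h f y y<T with output-kernel f (y % k ^ f) q∅ valid∅ (m%n<n y (k ^ f))
          where instance _ = k^≢0 f
        ... | q′ , valid′ , o = ≡.trans (≡.cong ã (split n)) (≡.trans (o _)
                (≡.trans (h q′ valid′ _ (ℕₚ.≤-<-trans (m/n≤m y (k ^ f)) y<T)) (≡.sym (≡.trans (≡.cong ã (split n′)) (o _)))))
          where
          instance _ = k^≢0 f
          alg : ∀ a n x y → a ℕ.* n ℕ.+ (a ℕ.* x ℕ.+ y) ≡ a ℕ.* (n ℕ.+ x) ℕ.+ y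
          alg = solve-∀
          split : ∀ n → k ^ f ℕ.* n ℕ.+ y ≡ k ^ f ℕ.* (n ℕ.+ y / k ^ f) ℕ.+ y % k ^ f
          split n = ≡.trans (≡.cong (k ^ f ℕ.* n ℕ.+_) (divMod y (k ^ f))) (alg (k ^ f) n _ _)

        transfer : ∀ n n′ {X} → n ≃ n′ → D ≤ X → X < T → Equation (k ^ d ℕ.* n′ ℕ.+ X) → Equation (k ^ d ℕ.* n ℕ.+ X)
        transfer n n′ {X} h D≤X X<T = trans (sum-cong-≋ (λ q → *-congˡ (reflexive (≡.trans (shift n q)
            (≡.trans (term-rel _≡_ (I q) X (J q) (λ y e → ≡.cong val (ã-local n n′ h (d ∸ I q) y (y<T q y e))) ≡.refl) (≡.sym (shift n′ q)))))))
          where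
          y<T : ∀ q y → X ≡ k ^ I q ℕ.* y ℕ.+ J q → y < T
          y<T q y e = ℕₚ.≤-<-trans (ℕₚ.≤-trans (ℕₚ.≤-trans (ℕₚ.m≤n*m y (k ^ I q) {{k^≢0 (I q)}}) (ℕₚ.m≤m+n _ (J q)))
                        (ℕₚ.≤-reflexive (≡.sym e))) X<T
          shift : ∀ n q → term 0# (val ∘ ã) (I q) (k ^ d ℕ.* n ℕ.+ X) (J q) ≡
                          term 0# (λ y → val (ã (k ^ (d ∸ I q) ℕ.* n ℕ.+ y))) (I q) X (J q)
          shift n q = term-shift n (I q) (J q) (ℕₚ.<⇒≤ (I< q)) (ℕₚ.≤-trans (J≤ q) D≤X)

        equation : ∀ N → Equation N
        equation N with N ℕ.<? D
        ... | yes N<D = small N (ℕₚ.≤-trans (ℕₚ.<⇒≤ N<D) D≤Y)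
        -- Passing to an equivalent `n′` below `k ^ codes` moves the equation into `[0 , Y]`, where
        -- the output agrees with `α`.
        ... | no N≮D = ≡.subst Equation (≡.sym N≡) (let n′ , n′< , h = shrink n in
                transfer n n′ h (ℕₚ.m≤m+n D _) X<T (small _ (ℕₚ.≤-trans (ℕₚ.+-mono-≤ (ℕₚ.*-monoʳ-≤ (k ^ d) (ℕₚ.<⇒≤ n′<)) (ℕₚ.<⇒≤ X<T)) Y≥)))
          where
          instance _ = k^≢0 d
          n = (N ∸ D) / k ^ d
          X = D ℕ.+ (N ∸ D) % k ^ d
          X<T : X < T
          X<T = ℕₚ.+-monoʳ-< D (m%n<n (N ∸ D) (k ^ d))
          alg : ∀ D a b → D ℕ.+ (a ℕ.+ b) ≡ a ℕ.+ (D ℕ.+ b)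
          alg = solve-∀
          N≡ : N ≡ k ^ d ℕ.* n ℕ.+ X
          N≡ = ≡.trans (≡.sym (ℕₚ.m+[n∸m]≡n (ℕₚ.≮⇒≥ N≮D))) (≡.trans (≡.cong (D ℕ.+_) (divMod (N ∸ D) (k ^ d))) (alg D (k ^ d ℕ.* n) _))

        -- Both sequences solve the equation and agree up to `D`; their difference takes at most
        -- `m * m` values, so `uniqueness` applies.
        everywhere : ∀ n → val (ã n) ≈ val (α n)
        everywhere n = x∙y⁻¹≈ε⇒x≈y _ _ (uniqueness P q₀ u u-inv (λ n → val (ã n) - val (α n)) (m ℕ.* m)
            (λ n → toℕ (combine (ã n) (α n))) (λ n → Finₚ.toℕ<n (combine (ã n) (α n))) label-≈
            (λ N → weighted-sub P _ _ _ (split N) (equation N) (eqn N))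
            (λ n n≤D → trans (+-congʳ (ã-agree n (ℕₚ.≤-trans n≤D D≤Y))) (-‿inverseʳ _)) n)
          where
          open Uniqueness k 2≤k S R
          open import Algebra.Properties.AbelianGroup +-abelianGroup using (x∙y⁻¹≈ε⇒x≈y)
          label-≈ : ∀ n n′ → toℕ (combine (ã n) (α n)) ≡ toℕ (combine (ã n′) (α n′)) → val (ã n) - val (α n) ≈ val (ã n′) - val (α n′)
          label-≈ n n′ eq with Finₚ.combine-injective (ã n) (α n) (ã n′) (α n′) (Finₚ.toℕ-injective eq)
          ... | eq₁ , eq₂ = +-cong (reflexive (≡.cong val eq₁)) (-‿cong (reflexive (≡.cong val eq₂)))
          split : ∀ N q → term 0# (λ n → val (ã n) - val (α n)) (I q) N (J q) ≈
            term 0# (val ∘ ã) (I q) N (J q) - term 0# (val ∘ α) (I q) N (J q)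
          split N q with hit? (I q) N (J q)
          ... | yes _ = refl
          ... | no _  = sym (-‿inverseʳ 0#)

        -- The index set contains every valid state, together with some pairs having `r ≥ k ^ e`.
        outputs : List (ℕ → Fin m)
        outputs = tabulate (λ (i : Fin (suc E ℕ.* k ^ E)) → let e , r = remQuot {suc E} (k ^ E) i in output (toℕ e , toℕ r))

        automatic : ∀ e r → r < k ^ e → Any (λ β → ∀ n → val (α (k ^ e ℕ.* n ℕ.+ r)) ≈ val (β n)) outputs
        automatic e r r< with output-kernel e r q∅ valid∅ r<
        ... | (e′ , r′) , (e′≤ , r′<) , o = Anyₚ.tabulate⁺ (combine {suc E} (fromℕ< (s≤s e′≤)) (fromℕ< r″))
                (λ n → trans (sym (everywhere _)) (reflexive (≡.cong val (≡.trans (o n) (≡.cong (λ q → output q n) (≡.sym state))))))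
          where
          r″ : r′ < k ^ E
          r″ = ℕₚ.<-≤-trans r′< (ℕₚ.^-monoʳ-≤ k e′≤)
          state : (let a , b = remQuot {suc E} (k ^ E) (combine {suc E} (fromℕ< (s≤s e′≤)) (fromℕ< r″)) in toℕ a , toℕ b) ≡ (e′ , r′)
          state = ≡.trans (≡.cong (λ { (a , b) → toℕ a , toℕ b }) (Finₚ.remQuot-combine {suc E} (fromℕ< (s≤s e′≤)) (fromℕ< r″)))
                    (≡.cong₂ _,_ (Finₚ.toℕ-fromℕ< (s≤s e′≤)) (Finₚ.toℕ-fromℕ< r″))

      finiteKernel : Σ (List (ℕ → Fin m)) λ L →
        ∀ e r → r < k ^ e → Any (λ β → ∀ n → val (α (k ^ e ℕ.* n ℕ.+ r)) ≈ val (β n)) L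
      finiteKernel with stable
      ... | E , E≤ , st = outputs , automatic
        where open Automaton E E≤ st

-- Coefficient lists of Mahler equations

AllPairs-lookup : ∀ {a r} {A : Set a} {_~_ : A → A → Set r} {xs : List A} → AllPairs _~_ xs →
  ∀ {i j} → toℕ i < toℕ j → lookup xs i ~ lookup xs j
AllPairs-lookup (p ∷ _)  {Fin.zero}  {Fin.suc j} _       = All.lookup p (∈-lookup j)
AllPairs-lookup (_ ∷ ps) {Fin.suc i} {Fin.suc j} (s≤s lt) = AllPairs-lookup ps lt

n<k^n : ∀ k → 2 ≤ k → ∀ n → n < k ^ n
n<k^n k 2≤k zero    = s≤s z≤n
n<k^n k 2≤k (suc n) = begin-strict
  suc n            ≤⟨ n<k^n k 2≤k n ⟩
  k ^ n            <⟨ ℕₚ.m<m+n (k ^ n) (ℕₚ.≤-<-trans z≤n (n<k^n k 2≤k n)) ⟩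
  k ^ n ℕ.+ k ^ n  ≡⟨ ≡.cong (k ^ n ℕ.+_) (ℕₚ.+-identityʳ (k ^ n)) ⟨
  2 ℕ.* k ^ n      ≤⟨ ℕₚ.*-monoˡ-≤ (k ^ n) 2≤k ⟩
  k ^ suc n        ∎
  where open ℕₚ.≤-Reasoning

module _ {c ℓ} (K : Field c ℓ) (k : ℕ) (2≤k : 2 ≤ k) where
  open Field K
  open Terms k 2≤k
  open Sums commutativeRing

  Entry : Set c
  Entry = Carrier × ℕ × ℕ

  row : ℕ → ℕ → Poly K → List Entry
  row i j []       = []
  row i j (x ∷ xs) = (x , i , j) ∷ row i (suc j) xs

  entries : ℕ → List (Poly K) → List Entry
  entries i []       = []
  entries i (p ∷ ps) = row i 0 p ++ entries (suc i) ps

  Lex : Entry → Entry → Set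
  Lex (_ , i , j) (_ , i′ , j′) = i < i′ ⊎ (i ≡ i′ × j < j′)

  row-bounds : ∀ i j p → All (λ { (_ , i′ , j′) → i′ ≡ i × j ≤ j′ × j′ < j ℕ.+ length p }) (row i j p)
  row-bounds i j []       = []
  row-bounds i j (x ∷ xs) = (≡.refl , ℕₚ.≤-refl , ℕₚ.m<m+n j (s≤s z≤n))
    ∷ All.map (λ { (e , l , u) → e , ℕₚ.<⇒≤ l , ℕₚ.<-≤-trans u (ℕₚ.≤-reflexive (≡.sym (ℕₚ.+-suc j (length xs)))) }) (row-bounds i (suc j) xs)

  width : List (Poly K) → ℕ
  width []       = 0
  width (p ∷ ps) = length p ℕ.+ width ps

  entries-bounds : ∀ i ps → All (λ { (_ , i′ , j′) → i ≤ i′ × i′ < i ℕ.+ length ps × j′ ≤ width ps }) (entries i ps)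
  entries-bounds i []       = []
  entries-bounds i (p ∷ ps) = Allₚ.++⁺
    (All.map (λ { (≡.refl , _ , u) → ℕₚ.≤-refl , ℕₚ.m<m+n i (s≤s z≤n) , ℕₚ.≤-trans (ℕₚ.<⇒≤ u) (ℕₚ.m≤m+n _ _) }) (row-bounds i 0 p))
    (All.map (λ { (l , u , b) → ℕₚ.<⇒≤ l , ℕₚ.<-≤-trans u (ℕₚ.≤-reflexive (≡.sym (ℕₚ.+-suc i (length ps))))
                              , ℕₚ.≤-trans b (ℕₚ.m≤n+m _ (length p)) }) (entries-bounds (suc i) ps))

  row-lex : ∀ i j p → AllPairs Lex (row i j p)
  row-lex i j []       = []
  row-lex i j (x ∷ xs) = All.map (λ { (e , l , _) → inj₂ (≡.sym e , l) }) (row-bounds i (suc j) xs) ∷ row-lex i (suc j) xs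

  entries-lex : ∀ i ps → AllPairs Lex (entries i ps)
  entries-lex i []       = []
  entries-lex i (p ∷ ps) = AllPairsₚ.++⁺ (row-lex i 0 p) (entries-lex (suc i) ps)
    (All.map (λ { (≡.refl , _) → All.map (λ { (l , _) → inj₁ l }) (entries-bounds (suc i) ps) }) (row-bounds i 0 p))

  coefficient : ∀ ps → Fin (length (entries 0 ps)) → Carrier
  coefficient ps q = proj₁ (lookup (entries 0 ps) q)

  shape : List (Poly K) → Shape
  shape ps = record
    { Q   = length (entries 0 ps)
    ; d   = length ps
    ; D   = width ps
    ; I   = λ q → proj₁ (proj₂ (lookup (entries 0 ps) q))
    ; J   = λ q → proj₂ (proj₂ (lookup (entries 0 ps) q))
    ; I<  = λ q → proj₁ (proj₂ (bounds q))
    ; J≤  = λ q → proj₂ (proj₂ (bounds q))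
    ; lex = AllPairs-lookup (entries-lex 0 ps)
    }
    where
    bounds = λ q → All.lookup (entries-bounds 0 ps) (∈-lookup q)

  unitEntry : ∀ i ps → Any (NonZeroPoly K) ps → Any (λ { (x , _) → ¬ (x ≈ 0#) }) (entries i ps)
  unitEntry i (p ∷ ps) (here h)  = Anyₚ.++⁺ˡ (inRow 0 p h)
    where
    inRow : ∀ j p → NonZeroPoly K p → Any (λ { (x , _) → ¬ (x ≈ 0#) }) (row i j p)
    inRow j (x ∷ xs) (here h)  = here h
    inRow j (x ∷ xs) (there h) = there (inRow (suc j) xs h)
  unitEntry i (p ∷ ps) (there h) = Anyₚ.++⁺ʳ (row i 0 p) (unitEntry (suc i) ps h)

  module _ {a b : ℕ → Carrier} (b≈a : ∀ n → b n ≈ a n) (N : ℕ) where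

    total : List Entry → Carrier
    total es = sum (λ q → let x , i , j = lookup es q in x * term 0# b i N j)

    total-++ : ∀ es es′ → total (es ++ es′) ≈ total es + total es′
    total-++ []       es′ = sym (+-identityˡ _)
    total-++ (e ∷ es) es′ = trans (+-congˡ (total-++ es es′)) (sym (+-assoc _ _ _))

    term-substPow : ∀ i j n → n ℕ.+ j ≡ N → term 0# b i N j ≈ substPow K (k ^ i) a n
    term-substPow i j n eq with (k ^ i) ∣? n
    ... | yes (divides m e) = trans (reflexive (term-hit i j (≡.trans (≡.sym eq)
                                (≡.cong (ℕ._+ j) (≡.trans e (ℕₚ.*-comm m (k ^ i))))))) (b≈a m)
    ... | no ¬div = term-elim (_≈ 0#) i N j (λ m e → ⊥-elim (¬div (divides m
                      (≡.trans (ℕₚ.+-cancelʳ-≡ j n _ (≡.trans eq e)) (ℕₚ.*-comm (k ^ i) m))))) refl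

    row-beyond : ∀ i j p → N < j → total (row i j p) ≈ 0#
    row-beyond i j []       N<j = refl
    row-beyond i j (x ∷ xs) N<j = trans (+-cong
      (trans (*-congˡ (term-elim (_≈ 0#) i N j (λ m e → ⊥-elim (ℕₚ.<⇒≱ N<j (≡.subst (j ≤_) (≡.sym e) (ℕₚ.m≤n+m j _)))) refl)) (zeroʳ x))
      (row-beyond i (suc j) xs (ℕₚ.m≤n⇒m≤1+n N<j))) (+-identityˡ 0#)

    -- The invariant `n + j ≡ N` links both recursions. `polyMul` stops at `n` = 0, where the
    -- remaining entries have exponents above `N` and contribute nothing.
    row-polyMul : ∀ i j p n → n ℕ.+ j ≡ N → polyMul K p (substPow K (k ^ i) a) n ≈ total (row i j p)
    row-polyMul i j []       n       eq = refl
    row-polyMul i j (x ∷ xs) zero    eq = trans (*-congˡ (sym (term-substPow i j 0 eq)))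
      (trans (sym (+-identityʳ _)) (+-congˡ (sym (row-beyond i (suc j) xs (s≤s (ℕₚ.≤-reflexive (≡.sym eq)))))))
    row-polyMul i j (x ∷ xs) (suc n) eq =
      +-cong (*-congˡ (sym (term-substPow i j (suc n) eq))) (row-polyMul i (suc j) xs n (≡.trans (ℕₚ.+-suc n j) eq))

    entries-mahlerSum : ∀ i ps → mahlerSumFrom K k i ps a N ≈ total (entries i ps)
    entries-mahlerSum i []       = refl
    entries-mahlerSum i (p ∷ ps) = trans (+-cong (row-polyMul i 0 p N (ℕₚ.+-identityʳ N)) (entries-mahlerSum (suc i) ps))
                                         (sym (total-++ (row i 0 p) (entries (suc i) ps)))

  -- The two implications

  natK-fold : ∀ n → natK K n ≡ fold 0# (1# +_) n
  natK-fold zero    = ≡.refl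
  natK-fold (suc n) = ≡.cong (1# +_) (natK-fold n)

  -- As `n < k ^ n`, the value `a n` is the first term of the kernel sequence of level `n` and
  -- residue `n`.
  automatic⇒finite : (a : Series K) → IsAutomatic K k a → FiniteRange K a
  automatic⇒finite a (L , h) = map (λ s → s 0) L , λ n → Anyₚ.map⁺
    (Any.map (λ e → trans (reflexive (≡.cong a (≡.sym (≡.cong (ℕ._+ n) (ℕₚ.*-zeroʳ (k ^ n)))))) (e 0)) (h n n (n<k^n k 2≤k n)))

  finite⇒automatic : CharZero K → (a : Series K) → IsMahler K k a → FiniteRange K a → IsAutomatic K k a
  finite⇒automatic char0 a (ps , nz , eqs) (L , range) = map (λ β n → val (β n)) (proj₁ finite)
    , λ e r r< → Anyₚ.map⁺ (Any.map (λ h n → trans (sym (val-α _)) (h n)) (proj₂ finite e r r<))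
    where
    S : Shape
    S = shape ps
    open Shape S
    P : Fin Q → Carrier
    P = coefficient ps
    val : Fin (length L) → Carrier
    val = lookup L
    α : ℕ → Fin (length L)
    -- List positions serve as labels with decidable equality; different labels may carry equal
    -- values.
    α n = Any.index (range n)
    val-α : ∀ n → val (α n) ≈ a n
    val-α n = sym (Anyₚ.lookup-index (range n))
    unit : Any (λ { (x , _) → ¬ (x ≈ 0#) }) (entries 0 ps)
    unit = unitEntry 0 ps nz
    q₀ : Fin Q
    q₀ = Any.index unit
    inv : Σ Carrier λ u → P q₀ * u ≈ 1#
    inv = inverse (P q₀) (Anyₚ.lookup-index unit)
    eqn : ∀ N → sum (λ q → P q * term 0# (val ∘ α) (I q) N (J q)) ≈ 0#
    eqn N = trans (sym (entries-mahlerSum val-α N 0 ps)) (eqs N)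
    natInverse : ∀ n → ∃ λ y → y * fold 0# (1# +_) (suc n) ≈ 1#
    -- Characteristic 0 enters here.
    natInverse n = let y , e = inverse (natK K (suc n)) (char0 n) in
      y , trans (*-congˡ (reflexive (≡.sym (natK-fold (suc n))))) (trans (*-comm y _) e)
    open Context k 2≤k S q₀ (length L)
    finite = Machine.finiteKernel k 2≤k S commutativeRing P q₀ (proj₁ inv) (proj₂ inv) (length L) val α eqn
      contexts offset M (ℕ.>-nonZero⁻¹ M {{W ℕₚ.!≢0}}) (context α)
      (Translation.translation k 2≤k S commutativeRing natInverse P q₀ (proj₁ inv) (proj₂ inv) (length L) val α eqn)
      -- `Y` is inferred to be the least bound that `Machine` admits.
      _ ℕₚ.≤-refl

theorem11p1 : ∀ {c ℓ} (K : Field c ℓ) → CharZero K → (k : ℕ) → 2 ≤ k →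
    (a : Series K) → IsMahler K k a →
    (IsAutomatic K k a ⇔ FiniteRange K a)
theorem11p1 K char0 k 2≤k a mahler = mk⇔ (automatic⇒finite K k 2≤k a) (finite⇒automatic K k 2≤k char0 a mahler)
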